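{- Let $G$ be the complement of a chain graph with bipartition $(X,Y)$, where $|X|=n$ and $|Y|=m$. Then $X$ and $Y$ are cliques of $G$, and removing the edges inside $X$ and inside $Y$ from $G$ leaves a chain graph $G^{\mathrm b}$. The number $p(G)$ of perfect matchings of $G$ is $$p(G)=\sum_{s=0}^{\min(n,m)} M(n,s)\cdot p(K_{n-s})\cdot p(K_{m-s}),$$ where $M(n,s)$ is the number of matchings of size exactly $s$ in $G^{\mathrm b}$. The values $M(i,s)$ are given by the recurrence $$M(i,0)=1\ (0\le i\le n),\qquad M(i,s)=0\ (0\le i<s\le n),$$ $$M(i,s)=M(i-1,s)+(\deg(x_i)-s+1)\,M(i-1,s-1)\quad(1\le s\le i\le n),$$ and can all be computed in $O(n^2)$ time; hence $p(G)$ can be computed in $O(n^2)$ time as well.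
   Context: A bipartite graph with bipartition $(X,Y)$ is a chain graph if for every pair of vertices $u,v\in X$ the neighbourhoods satisfy $\mathcal{N}(u)\subseteq\mathcal{N}(v)$ or $\mathcal{N}(u)\supseteq\mathcal{N}(v)$. Equivalently, the vertices of $X$ can be ordered $x_1,\ldots,x_n$ so that $\mathcal{N}(x_1)\subseteq\mathcal{N}(x_2)\subseteq\cdots\subseteq\mathcal{N}(x_n)$. In the recurrence, $x_1,\ldots,x_n$ is such an ordering for the chain graph $G^{\mathrm b}$, $\deg(x_i)$ is the degree of $x_i$ in $G^{\mathrm b}$, and $M(i,s)$ is the number of matchings of size exactly $s$ in the subgraph of $G^{\mathrm b}$ induced by $\{x_1,\ldots,x_i\}\cup Y$. For a graph $H$, $p(H)$ denotes the number of perfect matchings of $H$ (the empty graph has exactly one), and $K_t$ is the complete graph on $t$ vertices.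
   Formalization: Time is counted in arithmetic operations from n, m and the degrees deg(x_i) along a given ordering; p(G) is computed in O(n^2) only if the values p(K_t) are given, otherwise in O(n^2+m), since O(n^2) alone fails when m is much larger than n^2. -}

module Defs where

open import Data.Bool.Base using (if_then_else_)
open import Data.Fin.Base using (Fin; fromℕ<)
import Data.Fin.Base as Fin
import Data.Fin.Properties as Fin
open import Data.Fin.Subset using (Subset; _∈_; _⊆_; _∪_; _∩_; ⊥; ⊤; ⁅_⁆; ⋃; ∣_∣)
open import Data.Fin.Subset.Properties using (_∈?_; ∈⊤; x∈p∩q⁺)
open import Data.List.Base using (List; []; _∷_; _++_; map; filter; length; take; allFin; cartesianProduct)
open import Data.List.Relation.Unary.AllPairs using (AllPairs; allPairs?)
open import Data.List.Relation.Unary.Any using (Any; any?)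
open import Data.Nat.Base using (ℕ; zero; suc; _+_; _*_; _∸_; _≡ᵇ_)
import Data.Nat.Properties as ℕ
open import Data.Product.Base using (_×_; _,_; ∃; proj₁; swap)
open import Data.Sum.Base using (_⊎_)
open import Data.Vec.Base using (tabulate)
open import Function.Base using (_∘_)
open import Function.Definitions using (Injective)
open import Level using (0ℓ)
open import Relation.Binary.Core using (Rel)
open import Relation.Binary.Definitions using (Decidable; Symmetric; Irreflexive)
open import Relation.Binary.PropositionalEquality.Core using (_≡_; _≢_; ≢-sym)
open import Relation.Nullary.Decidable using (yes; no; does; ¬? ; _×-dec_; _⊎-dec_; _→-dec_)
open import Relation.Nullary.Negation using (¬_)
open import Relation.Unary using (Pred)
import Relation.Unary as Unary

------------------------------------------------------------------------
-- Finite simple graphs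

-- The vertex set is a subset of Fin N, so that an induced subgraph lives in
-- the same universe of vertices as the graph it comes from.
record Graph (N : ℕ) : Set₁ where
  field
    V      : Subset N
    Adj    : Rel (Fin N) 0ℓ
    adj?   : Decidable Adj
    adj-∈  : ∀ {u v} → Adj u v → u ∈ V
    symm   : Symmetric Adj
    irrefl : Irreflexive _≡_ Adj

open Graph public

complement : ∀ {N} → Graph N → Graph N
complement G = record
  { V      = V G
  ; Adj    = λ u v → (u ∈ V G × v ∈ V G) × u ≢ v × ¬ Adj G u v
  ; adj?   = λ u v → (u ∈? V G ×-dec v ∈? V G) ×-dec ¬? (u Fin.≟ v) ×-dec ¬? (adj? G u v)
  ; adj-∈  = λ a → proj₁ (proj₁ a)
  ; symm   = λ { (uv , u≢v , ¬a) → swap uv , ≢-sym u≢v , ¬a ∘ symm G }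
  ; irrefl = λ { u≡v (_ , u≢v , _) → u≢v u≡v }
  }

induce : ∀ {N} → Graph N → Subset N → Graph N
induce G S = record
  { V      = V G ∩ S
  ; Adj    = λ u v → (u ∈ S × v ∈ S) × Adj G u v
  ; adj?   = λ u v → (u ∈? S ×-dec v ∈? S) ×-dec adj? G u v
  ; adj-∈  = λ { ((u∈S , _) , a) → x∈p∩q⁺ (adj-∈ G a , u∈S) }
  ; symm   = λ { (uv , a) → swap uv , symm G a }
  ; irrefl = λ { u≡v (_ , a) → irrefl G u≡v a }
  }

removeEdgesInside : ∀ {N} → Subset N → Graph N → Graph N
removeEdgesInside S G = record
  { V      = V G
  ; Adj    = λ u v → Adj G u v × ¬ (u ∈ S × v ∈ S)
  ; adj?   = λ u v → adj? G u v ×-dec ¬? (u ∈? S ×-dec v ∈? S)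
  ; adj-∈  = λ { (a , _) → adj-∈ G a }
  ; symm   = λ { (a , ¬uv) → symm G a , ¬uv ∘ swap }
  ; irrefl = λ { u≡v (a , _) → irrefl G u≡v a }
  }

K : ∀ t → Graph t
K t = record
  { V      = ⊤
  ; Adj    = _≢_
  ; adj?   = λ u v → ¬? (u Fin.≟ v)
  ; adj-∈  = λ _ → ∈⊤
  ; symm   = ≢-sym
  ; irrefl = λ u≡v u≢v → u≢v u≡v
  }

𝒩 : ∀ {N} → Graph N → Fin N → Subset N
𝒩 G u = tabulate (λ v → does (adj? G u v))

deg : ∀ {N} → Graph N → Fin N → ℕ
deg G u = ∣ 𝒩 G u ∣

IsClique : ∀ {N} → Graph N → Subset N → Set
IsClique G S = S ⊆ V G × (∀ {u v} → u ∈ S → v ∈ S → u ≢ v → Adj G u v)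

------------------------------------------------------------------------
-- Matchings

-- An edge {u , v} is represented by the pair (u , v) with u < v.
Edge : ℕ → Set
Edge N = Fin N × Fin N

edges : ∀ {N} → Graph N → List (Edge N)
edges {N} G = filter (λ { (u , v) → (u Fin.<? v) ×-dec adj? G u v })
                     (cartesianProduct (allFin N) (allFin N))

Incident : ∀ {N} → Fin N → Edge N → Set
Incident w (u , v) = w ≡ u ⊎ w ≡ v

incident? : ∀ {N} → Decidable (Incident {N})
incident? w (u , v) = (w Fin.≟ u) ⊎-dec (w Fin.≟ v)

Disjoint : ∀ {N} → Rel (Edge N) 0ℓ
Disjoint (u , v) e = ¬ Incident u e × ¬ Incident v e

disjoint? : ∀ {N} → Decidable (Disjoint {N})
disjoint? (u , v) e = ¬? (incident? u e) ×-dec ¬? (incident? v e)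

IsMatching : ∀ {N} → Pred (List (Edge N)) 0ℓ
IsMatching = AllPairs Disjoint

Covers : ∀ {N} → Graph N → Pred (List (Edge N)) 0ℓ
Covers {N} G es = ∀ (w : Fin N) → w ∈ V G → Any (Incident w) es

covers? : ∀ {N} (G : Graph N) → Unary.Decidable (Covers G)
covers? G es = Fin.all? (λ w → (w ∈? V G) →-dec any? (incident? w) es)

subsets : ∀ {A : Set} → List A → List (List A)
subsets []       = [] ∷ []
subsets (x ∷ xs) = subsets xs ++ map (x ∷_) (subsets xs)

-- `edges G` has no repetitions, so the entries of `subsets (edges G)` are
-- exactly the sets of edges of G, each listed once.
numMatchings : ∀ {N} → Graph N → ℕ → ℕ
numMatchings G s =
  length (filter (λ es → allPairs? disjoint? es ×-dec (length es ℕ.≟ s))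
                 (subsets (edges G)))

p : ∀ {N} → Graph N → ℕ
p G = length (filter (λ es → allPairs? disjoint? es ×-dec covers? G es)
                     (subsets (edges G)))

------------------------------------------------------------------------
-- Chain graphs

record IsChainGraph {N} (G : Graph N) (X Y : Subset N) : Set where
  field
    cover    : X ∪ Y ≡ V G
    disjoint : X ∩ Y ≡ ⊥
    crossing : ∀ {u v} → Adj G u v → (u ∈ X × v ∈ Y) ⊎ (u ∈ Y × v ∈ X)
    chain    : ∀ {u v} → u ∈ X → v ∈ X → 𝒩 G u ⊆ 𝒩 G v ⊎ 𝒩 G v ⊆ 𝒩 G u

-- `x zero`, `x (suc zero)`, … are the vertices x₁, x₂, …
record IsChainOrdering {N n} (G : Graph N) (X : Subset N) (x : Fin n → Fin N) : Set where
  field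
    injective : Injective _≡_ _≡_ x
    into      : ∀ i → x i ∈ X
    onto      : ∀ {u} → u ∈ X → ∃ λ i → x i ≡ u
    nested    : ∀ {i j} → i Fin.≤ j → 𝒩 G (x i) ⊆ 𝒩 G (x j)

-- {x₁ , … , xᵢ}
initial : ∀ {N n} → (Fin n → Fin N) → ℕ → Subset N
initial {n = n} x i = ⋃ (map (⁅_⁆ ∘ x) (take i (allFin n)))

record CoChain (n m : ℕ) : Set₁ where
  field
    {N}     : ℕ
    H       : Graph N
    X Y     : Subset N
    isChain : IsChainGraph H X Y
    ∣X∣≡n   : ∣ X ∣ ≡ n
    ∣Y∣≡m   : ∣ Y ∣ ≡ m

  G : Graph N
  G = complement H

  Gᵇ : Graph N
  Gᵇ = removeEdgesInside Y (removeEdgesInside X G)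

  Ordering : Set
  Ordering = ∃ λ (x : Fin n → Fin N) → IsChainOrdering Gᵇ X x

  degree : Ordering → Fin n → ℕ
  degree (x , _) i = deg Gᵇ (x i)

  M : Ordering → ℕ → ℕ → ℕ
  M (x , _) i s = numMatchings (induce Gᵇ (initial x i ∪ Y)) s

------------------------------------------------------------------------
-- Running time: a unit-cost random access machine over ℕ

-- A program uses finitely many registers and arrays, each named by a number.
-- Counted loops are the only control structure; such programs run on the
-- usual unit-cost RAM with at most a constant factor of slowdown.

data Expr : Set where
  lit         : ℕ → Expr
  reg         : ℕ → Expr
  _[_]        : ℕ → Expr → Expr
  _⊕_ _⊖_ _⊗_ : Expr → Expr → Expr

infixr 5 _⨟_

data Program : Set where
  _≔_     : ℕ → Expr → Program
  _[_]≔_  : ℕ → Expr → Expr → Program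
  _⨟_     : Program → Program → Program
  for_<_⟨_⟩ : ℕ → Expr → Program → Program

record State : Set where
  constructor ⟪_,_⟫
  field
    register : ℕ → ℕ
    array    : ℕ → ℕ → ℕ

open State public

_[_↦_] : ∀ {A : Set} → (ℕ → A) → ℕ → A → (ℕ → A)
(f [ i ↦ a ]) j = if i ≡ᵇ j then a else f j

setReg : ℕ → ℕ → State → State
setReg r a ⟪ ρ , α ⟫ = ⟪ ρ [ r ↦ a ] , α ⟫

setArr : ℕ → ℕ → ℕ → State → State
setArr b i a ⟪ ρ , α ⟫ = ⟪ ρ , α [ b ↦ α b [ i ↦ a ] ] ⟫

eval : Expr → State → ℕ
eval (lit k)   σ = k
eval (reg r)   σ = register σ r
eval (b [ e ]) σ = array σ b (eval e σ)
eval (e ⊕ f)   σ = eval e σ + eval f σ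
eval (e ⊖ f)   σ = eval e σ ∸ eval f σ
eval (e ⊗ f)   σ = eval e σ * eval f σ

cost : Expr → ℕ
cost (lit k)   = 1
cost (reg r)   = 1
cost (b [ e ]) = suc (cost e)
cost (e ⊕ f)   = suc (cost e + cost f)
cost (e ⊖ f)   = suc (cost e + cost f)
cost (e ⊗ f)   = suc (cost e + cost f)

-- `for r < e ⟨ P ⟩` evaluates e once, to k say, and then runs P with register r
-- set to 0 , 1 , … , k ∸ 1 in turn.
mutual
  exec : Program → State → State
  exec (r ≔ e)          σ = setReg r (eval e σ) σ
  exec (b [ e ]≔ f)     σ = setArr b (eval e σ) (eval f σ) σ
  exec (P ⨟ Q)          σ = exec Q (exec P σ)
  exec (for r < e ⟨ P ⟩) σ = loop r P (eval e σ) σ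

  loop : ℕ → Program → ℕ → State → State
  loop r P zero    σ = σ
  loop r P (suc k) σ = exec P (setReg r k (loop r P k σ))

mutual
  time : Program → State → ℕ
  time (r ≔ e)          σ = suc (cost e)
  time (b [ e ]≔ f)     σ = suc (cost e + cost f)
  time (P ⨟ Q)          σ = time P σ + time Q (exec P σ)
  time (for r < e ⟨ P ⟩) σ = suc (cost e + loopTime r P (eval e σ) σ)

  loopTime : ℕ → Program → ℕ → State → ℕ
  loopTime r P zero    σ = 0
  loopTime r P (suc k) σ =
    loopTime r P k σ + suc (time P (setReg r k (loop r P k σ)))

extend : ∀ {k} → (Fin k → ℕ) → ℕ → ℕ
extend {k} f i with i ℕ.<? k
... | yes i<k = f (fromℕ< i<k)
... | no  _   = 0

-- Registers 0 and 1 hold n and m, array 0 holds deg x₁ , … , deg xₙ (from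
-- index 0 on) and array 1 holds the table a; everything else is 0.
input : (n m : ℕ) → (Fin n → ℕ) → (a : ℕ → ℕ) → State
input n m d a = ⟪ (λ _ → 0) [ 0 ↦ n ] [ 1 ↦ m ] , (λ _ _ → 0) [ 0 ↦ extend d ] [ 1 ↦ a ] ⟫

-- The table of M(i , s), 0 ≤ i , s ≤ n, is left row by row in array 2.
tableEntry : (n i s : ℕ) → State → ℕ
tableEntry n i s σ = array σ 2 (i * suc n + s)

result : State → ℕ
result σ = register σ 2

{-# OPTIONS --safe #-}
-- A perfect matching of G is a matching a of Gᵇ, of size s say, together with
-- perfect matchings of the n ∸ s vertices of X and of the m ∸ s vertices of Y
-- that a leaves uncovered; these span complete graphs.  In the graph on
-- {x₁ , … , xᵢ₊₁} ∪ Y a matching of size s + 1 either avoids xᵢ₊₁ or consists of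
-- an edge xᵢ₊₁y and of a matching b of size s below.  As the neighbourhoods are
-- nested, the s vertices of Y covered by b are all neighbours of xᵢ₊₁, which
-- leaves deg(xᵢ₊₁) ∸ s choices for y.

module Submission where

open import Defs
open import Data.Fin.Base using (Fin; toℕ)
open import Data.List.Base using (map; sum; upTo)
open import Data.Nat.Base using (ℕ; suc; _+_; _*_; _∸_; _⊓_; _⊔_; _≤_; _<_)
open import Data.Product.Base using (_×_; ∃-syntax)
open import Relation.Binary.PropositionalEquality.Core using (_≡_)

open import Algebra.Properties.CommutativeSemigroup using (interchange)
open import Data.Bool.Base using (true; false; if_then_else_)
import Data.Fin.Base as Fin
open import Data.Fin.Base using (zero; suc; fromℕ<)
import Data.Fin.Properties as Fin
import Data.Fin.Subset as Subset
open import Data.Fin.Subset using (Subset; inside; outside; _∪_; ⋃; ⁅_⁆)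
import Data.Fin.Subset.Properties as Subset
import Data.Integer.Properties as ℤ
import Data.Integer.Tactic.RingSolver as ℤSolver
open import Data.List.Base
  using (List; []; _∷_; _++_; filter; length; take; tabulate; allFin; applyUpTo; cartesianProduct)
open import Data.List.Membership.Propositional using (_∈_; _∉_; lose)
open import Data.List.Membership.Propositional.Properties
  using (∈-++⁺ˡ; ∈-++⁺ʳ; ∈-++⁻; ∈-map⁺; ∈-map⁻; ∈-filter⁺; ∈-filter⁻; ∈-cartesianProduct⁺; ∈-allFin)
open import Data.List.Membership.Propositional.Properties.WithK using (unique∧set⇒bag)
open import Data.List.Properties
  using (filter-accept; filter-reject; filter-all; filter-none; filter-++; map-∘; length-map; length-tabulate)
open import Data.List.Relation.Binary.BagAndSetEquality using (∼bag⇒↭)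
import Data.List.Relation.Binary.Permutation.Propositional as Perm
open import Data.List.Relation.Binary.Permutation.Propositional using (_↭_; ↭-prep; ↭-swap)
open import Data.List.Relation.Binary.Permutation.Propositional.Properties
  using (Any-resp-↭; All-resp-↭; ↭-length)
open import Data.List.Relation.Unary.All using (All; []; _∷_; all?)
import Data.List.Relation.Unary.All as All
import Data.List.Relation.Unary.All.Properties as All
open import Data.List.Relation.Unary.AllPairs using (AllPairs; []; _∷_; allPairs?)
import Data.List.Relation.Unary.AllPairs as AllPairs using (map)
import Data.List.Relation.Unary.AllPairs.Properties as AllPairs
open import Data.List.Relation.Unary.Any using (Any; here; there; any?)
import Data.List.Relation.Unary.Any.Properties as Any
open import Data.List.Relation.Unary.Unique.Propositional using (Unique)
import Data.List.Relation.Unary.Unique.Propositional.Properties as Unique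
open import Data.Nat.Base using (zero; z≤n; s≤s; _≡ᵇ_)
import Data.Nat.Properties as ℕ
open import Data.Nat.Tactic.RingSolver using (solve-∀)
open import Data.Product.Base using (_,_; ∃; proj₁; proj₂)
open import Data.Sum.Base using (_⊎_; inj₁; inj₂; [_,_]′; swap)
open import Data.Vec.Base using ([]; _∷_)
import Data.Vec.Base as Vec
import Data.Vec.Properties as Vec
open import Function.Base using (_∘_; id)
open import Function.Bundles using (_⇔_; mk⇔; Equivalence)
open import Level using (0ℓ)
open import Relation.Binary.Core using (Rel)
open import Relation.Binary.Definitions using (tri<; tri≈; tri>)
open import Relation.Binary.PropositionalEquality
  using (_≢_; refl; sym; trans; cong; cong₂; subst; module ≡-Reasoning)
open import Relation.Nullary.Decidable
  using (Dec; yes; no; does; ¬?; _×-dec_; does-⇔; dec-true; dec-false)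
open import Relation.Nullary.Negation using (¬_; contradiction)
open import Relation.Unary using (Pred; Decidable)

-- Every count becomes a sum of 0/1 indicators over the sublists of an edge list. Bijections between
-- sets of matchings then turn into identities between sums, proved by recursion on the list. The
-- indicators concerned are invariant under permutation, so an edge list may be regrouped at will:
-- crossing edges before the edges of the two cliques, edges at xᵢ₊₁ before all others. Both halves
-- of the argument rest on one count, `length-uncovered`: if every edge of a matching has exactly
-- one end in a set, the matching uses up as many vertices of the set as it has edges. Applied to X
-- and to Y it fixes the sizes of the cliques left over; applied to the neighbourhood of xᵢ₊₁ it
-- yields the factor deg(xᵢ₊₁) ∸ s. The coefficient in the theorem is an integer and may be
-- negative, but the same count shows that M(i , s) is then 0. Truncated subtraction therefore gives
-- the same values, and a machine over ℕ can compute them.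

private
  variable
    A B : Set
    P Q : Set
    N : ℕ

-- Indicators and sums

⟦_⟧ : Dec P → ℕ
⟦ P? ⟧ = if does P? then 1 else 0

⟦⟧-true : (P? : Dec P) → P → ⟦ P? ⟧ ≡ 1
⟦⟧-true P? p = cong (if_then 1 else 0) (dec-true P? p)

⟦⟧-false : (P? : Dec P) → ¬ P → ⟦ P? ⟧ ≡ 0
⟦⟧-false P? ¬p = cong (if_then 1 else 0) (dec-false P? ¬p)

⟦⟧-cong : (P? : Dec P) (Q? : Dec Q) → P ⇔ Q → ⟦ P? ⟧ ≡ ⟦ Q? ⟧
⟦⟧-cong P? Q? P⇔Q = cong (if_then 1 else 0) (does-⇔ P⇔Q P? Q?)

⟦⟧-× : (P? : Dec P) (Q? : Dec Q) → ⟦ P? ×-dec Q? ⟧ ≡ ⟦ P? ⟧ * ⟦ Q? ⟧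
⟦⟧-× P? Q? with does P?
... | true  = sym (ℕ.*-identityˡ _)
... | false = refl

⟦⟧-idem : (P? : Dec P) → ⟦ P? ⟧ * ⟦ P? ⟧ ≡ ⟦ P? ⟧
⟦⟧-idem P? with does P?
... | true  = refl
... | false = refl

-- Facts that hold only for matchings can thus be used inside sums that run over all sublists.
⟦⟧-*-cong : (P? : Dec P) {a b : ℕ} → (P → a ≡ b) → ⟦ P? ⟧ * a ≡ ⟦ P? ⟧ * b
⟦⟧-*-cong (yes p) a≡b = cong (1 *_) (a≡b p)
⟦⟧-*-cong (no _)  a≡b = refl

∑ : List A → (A → ℕ) → ℕ
∑ xs f = sum (map f xs)

∑-cong : ∀ (xs : List A) {f g : A → ℕ} → (∀ {x} → x ∈ xs → f x ≡ g x) → ∑ xs f ≡ ∑ xs g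
∑-cong []       f≡g = refl
∑-cong (x ∷ xs) f≡g = cong₂ _+_ (f≡g (here refl)) (∑-cong xs (f≡g ∘ there))

∑-++ : ∀ (xs ys : List A) (f : A → ℕ) → ∑ (xs ++ ys) f ≡ ∑ xs f + ∑ ys f
∑-++ []       ys f = refl
∑-++ (x ∷ xs) ys f = trans (cong (f x +_) (∑-++ xs ys f)) (sym (ℕ.+-assoc (f x) _ _))

∑-map : ∀ (h : B → A) (xs : List B) (f : A → ℕ) → ∑ (map h xs) f ≡ ∑ xs (f ∘ h)
∑-map h xs f = cong sum (sym (map-∘ xs))

∑-zero : ∀ (xs : List A) {f : A → ℕ} → (∀ {x} → x ∈ xs → f x ≡ 0) → ∑ xs f ≡ 0
∑-zero []       f≡0 = refl
∑-zero (x ∷ xs) f≡0 = cong₂ _+_ (f≡0 (here refl)) (∑-zero xs (f≡0 ∘ there))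

∑-const : ∀ (xs : List A) c → ∑ xs (λ _ → c) ≡ length xs * c
∑-const []       c = refl
∑-const (_ ∷ xs) c = cong (c +_) (∑-const xs c)

∑-+ : ∀ (xs : List A) (f g : A → ℕ) → ∑ xs (λ x → f x + g x) ≡ ∑ xs f + ∑ xs g
∑-+ []       f g = refl
∑-+ (x ∷ xs) f g = trans (cong (f x + g x +_) (∑-+ xs f g)) (interchange ℕ.+-commutativeSemigroup (f x) (g x) _ _)

∑-*ˡ : ∀ c (xs : List A) (f : A → ℕ) → ∑ xs (λ x → c * f x) ≡ c * ∑ xs f
∑-*ˡ c []       f = sym (ℕ.*-zeroʳ c)
∑-*ˡ c (x ∷ xs) f = trans (cong (c * f x +_) (∑-*ˡ c xs f)) (sym (ℕ.*-distribˡ-+ c (f x) _))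

∑-*ʳ : ∀ c (xs : List A) (f : A → ℕ) → ∑ xs (λ x → f x * c) ≡ ∑ xs f * c
∑-*ʳ c []       f = refl
∑-*ʳ c (x ∷ xs) f = trans (cong (f x * c +_) (∑-*ʳ c xs f)) (sym (ℕ.*-distribʳ-+ c (f x) _))

∑-swap : ∀ (xs : List A) (ys : List B) (f : A → B → ℕ) →
         ∑ xs (λ x → ∑ ys (f x)) ≡ ∑ ys (λ y → ∑ xs (λ x → f x y))
∑-swap []       ys f = sym (∑-zero ys (λ _ → refl))
∑-swap (x ∷ xs) ys f = trans (cong (∑ ys (f x) +_) (∑-swap xs ys f)) (sym (∑-+ ys (f x) _))

∑-* : ∀ (xs : List A) (ys : List B) (f : A → ℕ) (g : B → ℕ) →
      ∑ xs (λ x → ∑ ys (λ y → f x * g y)) ≡ ∑ xs f * ∑ ys g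
∑-* xs ys f g = trans (∑-cong xs (λ {x} _ → ∑-*ˡ (f x) ys g)) (∑-*ʳ (∑ ys g) xs f)

length-filter-∑ : ∀ {P : Pred A 0ℓ} (P? : Decidable P) xs →
                  length (filter P? xs) ≡ ∑ xs (λ x → ⟦ P? x ⟧)
length-filter-∑ P? [] = refl
length-filter-∑ P? (x ∷ xs) with does (P? x)
... | true  = cong suc (length-filter-∑ P? xs)
... | false = length-filter-∑ P? xs

∑-upTo-suc : ∀ k (f : ℕ → ℕ) → ∑ (upTo (suc k)) f ≡ ∑ (upTo k) f + f k
∑-upTo-suc k f = go k f id
  where
  -- `applyUpTo` recurses from the front by composing with `suc`, so the induction needs an
  -- arbitrary `g` in place of `id`.
  go : ∀ k (f g : ℕ → ℕ) → ∑ (applyUpTo g (suc k)) f ≡ ∑ (applyUpTo g k) f + f (g k)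
  go zero    f g = ℕ.+-identityʳ _
  go (suc k) f g = trans (cong (f (g 0) +_) (go k f (g ∘ suc))) (sym (ℕ.+-assoc (f (g 0)) _ _))

∑-upTo-indicator : ∀ k l (f : ℕ → ℕ) → l < k → ∑ (upTo k) (λ s → ⟦ l ℕ.≟ s ⟧ * f s) ≡ f l
∑-upTo-indicator zero    l f ()
∑-upTo-indicator (suc k) l f l<1+k with l ℕ.≟ k
... | yes refl = begin
  ∑ (upTo (suc k)) (λ s → ⟦ k ℕ.≟ s ⟧ * f s)            ≡⟨ ∑-upTo-suc k _ ⟩
  ∑ (upTo k) (λ s → ⟦ k ℕ.≟ s ⟧ * f s) + ⟦ k ℕ.≟ k ⟧ * f k
    ≡⟨ cong₂ _+_ (below k k f ℕ.≤-refl) (cong (_* f k) (⟦⟧-true (k ℕ.≟ k) refl)) ⟩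
  1 * f k                                               ≡⟨ ℕ.*-identityˡ (f k) ⟩
  f k                                                   ∎
  where
  open ≡-Reasoning
  below : ∀ k l (f : ℕ → ℕ) → k ≤ l → ∑ (upTo k) (λ s → ⟦ l ℕ.≟ s ⟧ * f s) ≡ 0
  below zero    l f k≤l = refl
  below (suc k) l f k<l = trans (∑-upTo-suc k _)
    (cong₂ _+_ (below k l f (ℕ.<⇒≤ k<l)) (cong (_* f k) (⟦⟧-false (l ℕ.≟ k) (ℕ.>⇒≢ k<l))))
... | no l≢k = begin
  ∑ (upTo (suc k)) (λ s → ⟦ l ℕ.≟ s ⟧ * f s)            ≡⟨ ∑-upTo-suc k _ ⟩
  ∑ (upTo k) (λ s → ⟦ l ℕ.≟ s ⟧ * f s) + ⟦ l ℕ.≟ k ⟧ * f k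
    ≡⟨ cong₂ _+_ (∑-upTo-indicator k l f (ℕ.≤∧≢⇒< (ℕ.≤-pred l<1+k) l≢k)) (cong (_* f k) (⟦⟧-false (l ℕ.≟ k) l≢k)) ⟩
  f l + 0                                               ≡⟨ ℕ.+-identityʳ (f l) ⟩
  f l                                                   ∎
  where open ≡-Reasoning

-- Sums over the sublists of a list

∑-subsets-∷ : ∀ x (xs : List A) f →
              ∑ (subsets (x ∷ xs)) f ≡ ∑ (subsets xs) f + ∑ (subsets xs) (f ∘ (x ∷_))
∑-subsets-∷ x xs f =
  trans (∑-++ (subsets xs) _ f) (cong (∑ (subsets xs) f +_) (∑-map (x ∷_) (subsets xs) f))

subsets-⊆ : ∀ (xs : List A) {a} → a ∈ subsets xs → All (_∈ xs) a
subsets-⊆ []       (here refl) = []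
subsets-⊆ (x ∷ xs) a∈ with ∈-++⁻ (subsets xs) a∈
... | inj₁ a∈xs = All.map there (subsets-⊆ xs a∈xs)
... | inj₂ a∈x∷ with ∈-map⁻ (x ∷_) a∈x∷
...   | b , b∈xs , refl = here refl ∷ All.map there (subsets-⊆ xs b∈xs)

∑-subsets-++ : ∀ (xs ys : List A) f →
               ∑ (subsets (xs ++ ys)) f ≡ ∑ (subsets xs) (λ a → ∑ (subsets ys) (λ b → f (a ++ b)))
∑-subsets-++ []       ys f = sym (ℕ.+-identityʳ _)
∑-subsets-++ (x ∷ xs) ys f = begin
  ∑ (subsets (x ∷ xs ++ ys)) f
    ≡⟨ ∑-subsets-∷ x (xs ++ ys) f ⟩
  ∑ (subsets (xs ++ ys)) f + ∑ (subsets (xs ++ ys)) (f ∘ (x ∷_))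
    ≡⟨ cong₂ _+_ (∑-subsets-++ xs ys f) (∑-subsets-++ xs ys (f ∘ (x ∷_))) ⟩
  ∑ (subsets xs) g + ∑ (subsets xs) (g ∘ (x ∷_))
    ≡⟨ ∑-subsets-∷ x xs g ⟨
  ∑ (subsets (x ∷ xs)) g ∎
  where
  open ≡-Reasoning
  g : List _ → ℕ
  g a = ∑ (subsets ys) (λ b → f (a ++ b))

-- Permuting the list permutes the entries inside each sublist as well, hence the invariance
-- demanded of `f`.
∑-subsets-↭ : ∀ {xs ys : List A} (f : List A → ℕ) → (∀ {a b} → a ↭ b → f a ≡ f b) →
              xs ↭ ys → ∑ (subsets xs) f ≡ ∑ (subsets ys) f
∑-subsets-↭ f f-↭ Perm.refl = refl
∑-subsets-↭ {xs = x ∷ xs} {_ ∷ ys} f f-↭ (Perm.prep x xs↭ys) = begin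
  ∑ (subsets (x ∷ xs)) f                          ≡⟨ ∑-subsets-∷ x xs f ⟩
  ∑ (subsets xs) f + ∑ (subsets xs) (f ∘ (x ∷_))
    ≡⟨ cong₂ _+_ (∑-subsets-↭ f f-↭ xs↭ys) (∑-subsets-↭ (f ∘ (x ∷_)) (f-↭ ∘ ↭-prep x) xs↭ys) ⟩
  ∑ (subsets ys) f + ∑ (subsets ys) (f ∘ (x ∷_))  ≡⟨ ∑-subsets-∷ x ys f ⟨
  ∑ (subsets (x ∷ ys)) f                          ∎
  where open ≡-Reasoning
-- Four blocks of sublists: neither, `y` only, `x` only, both. The swap exchanges the middle two,
-- and the last is matched by the invariance of `f`.
∑-subsets-↭ {xs = x ∷ y ∷ xs} {_ ∷ _ ∷ ys} f f-↭ (Perm.swap x y xs↭ys) = begin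
  ∑ (subsets (x ∷ y ∷ xs)) f                      ≡⟨ expand x y xs ⟩
  (s xs f + s xs (f ∘ (y ∷_))) + (s xs (f ∘ (x ∷_)) + s xs (f ∘ (x ∷_) ∘ (y ∷_)))
    ≡⟨ cong₂ _+_ (cong₂ _+_ (∑-subsets-↭ f f-↭ xs↭ys) (∑-subsets-↭ (f ∘ (y ∷_)) (f-↭ ∘ ↭-prep y) xs↭ys))
                 (cong₂ _+_ (∑-subsets-↭ (f ∘ (x ∷_)) (f-↭ ∘ ↭-prep x) xs↭ys)
                   (trans (∑-subsets-↭ _ (f-↭ ∘ ↭-prep x ∘ ↭-prep y) xs↭ys)
                          (∑-cong (subsets ys) (λ _ → f-↭ (↭-swap x y Perm.refl))))) ⟩
  (s ys f + s ys (f ∘ (y ∷_))) + (s ys (f ∘ (x ∷_)) + s ys (f ∘ (y ∷_) ∘ (x ∷_)))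
    ≡⟨ interchange ℕ.+-commutativeSemigroup (s ys f) _ _ _ ⟩
  (s ys f + s ys (f ∘ (x ∷_))) + (s ys (f ∘ (y ∷_)) + s ys (f ∘ (y ∷_) ∘ (x ∷_)))
    ≡⟨ expand y x ys ⟨
  ∑ (subsets (y ∷ x ∷ ys)) f                      ∎
  where
  open ≡-Reasoning
  s : List _ → (List _ → ℕ) → ℕ
  s zs = ∑ (subsets zs)
  expand : ∀ x y zs → s (x ∷ y ∷ zs) f
         ≡ (s zs f + s zs (f ∘ (y ∷_))) + (s zs (f ∘ (x ∷_)) + s zs (f ∘ (x ∷_) ∘ (y ∷_)))
  expand x y zs = trans (∑-subsets-∷ x (y ∷ zs) f) (cong₂ _+_ (∑-subsets-∷ y zs f) (∑-subsets-∷ y zs _))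
∑-subsets-↭ f f-↭ (Perm.trans xs↭ys ys↭zs) =
  trans (∑-subsets-↭ f f-↭ xs↭ys) (∑-subsets-↭ f f-↭ ys↭zs)

-- Absorbs a condition on single edges into the edge list, so that matchings avoiding some vertices
-- become matchings of a smaller graph.
∑-subsets-filter : ∀ {Q : Pred A 0ℓ} (Q? : Decidable Q) xs (f : List A → ℕ) →
  ∑ (subsets xs) (λ a → ⟦ all? Q? a ⟧ * f a) ≡ ∑ (subsets (filter Q? xs)) f
∑-subsets-filter Q? []       f = cong (_+ 0) (ℕ.*-identityˡ _)
∑-subsets-filter {Q = Q} Q? (x ∷ xs) f with Q? x
... | yes q = begin
  ∑ (subsets (x ∷ xs)) (λ a → ⟦ all? Q? a ⟧ * f a)
    ≡⟨ ∑-subsets-∷ x xs _ ⟩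
  ∑ (subsets xs) (λ a → ⟦ all? Q? a ⟧ * f a) + ∑ (subsets xs) (λ a → ⟦ all? Q? (x ∷ a) ⟧ * f (x ∷ a))
    ≡⟨ cong₂ _+_ (∑-subsets-filter Q? xs f)
         (trans (∑-cong (subsets xs) (λ {a} _ → cong (_* f (x ∷ a))
                  (⟦⟧-cong (all? Q? (x ∷ a)) (all? Q? a) (mk⇔ All.tail (q ∷_)))))
                (∑-subsets-filter Q? xs (f ∘ (x ∷_)))) ⟩
  ∑ (subsets (filter Q? xs)) f + ∑ (subsets (filter Q? xs)) (f ∘ (x ∷_))
    ≡⟨ ∑-subsets-∷ x (filter Q? xs) f ⟨
  ∑ (subsets (x ∷ filter Q? xs)) f ∎
  where open ≡-Reasoning
... | no ¬q = begin
  ∑ (subsets (x ∷ xs)) (λ a → ⟦ all? Q? a ⟧ * f a)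
    ≡⟨ ∑-subsets-∷ x xs _ ⟩
  ∑ (subsets xs) (λ a → ⟦ all? Q? a ⟧ * f a) + ∑ (subsets xs) (λ a → ⟦ all? Q? (x ∷ a) ⟧ * f (x ∷ a))
    ≡⟨ cong₂ _+_ (∑-subsets-filter Q? xs f)
         (∑-zero (subsets xs) (λ {a} _ → cong (_* f (x ∷ a)) (⟦⟧-false (all? Q? (x ∷ a)) (¬q ∘ All.head)))) ⟩
  ∑ (subsets (filter Q? xs)) f + 0
    ≡⟨ ℕ.+-identityʳ _ ⟩
  ∑ (subsets (filter Q? xs)) f ∎
  where open ≡-Reasoning

-- Meant for the edges at one vertex: no two of them are disjoint, so a matching contains at most
-- one.
∑-subsets-sparse : ∀ (xs : List A) (f : List A → ℕ) →
  (∀ {x y} → x ∈ xs → y ∈ xs → ∀ a → f (x ∷ y ∷ a) ≡ 0) →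
  ∑ (subsets xs) f ≡ f [] + ∑ xs (λ x → f (x ∷ []))
∑-subsets-sparse []       f sparse = refl
∑-subsets-sparse (x ∷ xs) f sparse = begin
  ∑ (subsets (x ∷ xs)) f
    ≡⟨ ∑-subsets-∷ x xs f ⟩
  ∑ (subsets xs) f + ∑ (subsets xs) (f ∘ (x ∷_))
    ≡⟨ cong₂ _+_ (∑-subsets-sparse xs f (λ x∈ y∈ → sparse (there x∈) (there y∈)))
         (trans (∑-subsets-sparse xs (f ∘ (x ∷_)) (λ x∈ _ a → sparse (here refl) (there x∈) _))
                (cong (f (x ∷ []) +_) (∑-zero xs (λ y∈ → sparse (here refl) (there y∈) [])))) ⟩
  (f [] + ∑ xs (λ x → f (x ∷ []))) + (f (x ∷ []) + 0)
    ≡⟨ rearrange (f []) _ (f (x ∷ [])) ⟩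
  f [] + (f (x ∷ []) + ∑ xs (λ x → f (x ∷ []))) ∎
  where
  open ≡-Reasoning
  rearrange : ∀ a b c → (a + b) + (c + 0) ≡ a + (c + b)
  rearrange = solve-∀

-- Lists without repetitions

unique∧set⇒↭ : ∀ {xs ys : List A} → Unique xs → Unique ys → (∀ {x} → x ∈ xs ⇔ x ∈ ys) → xs ↭ ys
unique∧set⇒↭ u v eq = ∼bag⇒↭ (unique∧set⇒bag u v eq)

-- Since `t` occurs once, the two filters differ at that single place and agree before and after it.
length-filter-remove : ∀ {P Q : Pred A 0ℓ} (P? : Decidable P) (Q? : Decidable Q) {xs : List A} {t} →
  Unique xs → t ∈ xs → Q t → (∀ {x} → x ∈ xs → P x ⇔ (Q x × x ≢ t)) →
  suc (length (filter P? xs)) ≡ length (filter Q? xs)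
length-filter-remove {P = P} {Q} P? Q? {x ∷ xs} (x∉ ∷ u) (here refl) Qt P⇔ =
  trans (cong (suc ∘ length) (trans (filter-reject P? (λ px → proj₂ (Equivalence.to (P⇔ (here refl)) px) refl))
                                    (same xs x∉ (P⇔ ∘ there))))
        (cong length (sym (filter-accept Q? Qt)))
  where
  same : ∀ ys → All (x ≢_) ys → (∀ {y} → y ∈ ys → P y ⇔ (Q y × y ≢ x)) → filter P? ys ≡ filter Q? ys
  same []       []         P⇔ = refl
  same (y ∷ ys) (x≢y ∷ x∉) P⇔ with Q? y
  ... | yes q = trans (filter-accept P? (Equivalence.from (P⇔ (here refl)) (q , x≢y ∘ sym)))
                      (cong (y ∷_) (same ys x∉ (P⇔ ∘ there)))
  ... | no ¬q = trans (filter-reject P? (¬q ∘ proj₁ ∘ Equivalence.to (P⇔ (here refl)))) (same ys x∉ (P⇔ ∘ there))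
length-filter-remove P? Q? {x ∷ xs} (x∉ ∷ u) (there t∈) Qt P⇔ with Q? x
... | yes q = trans (cong (suc ∘ length) (filter-accept P? (Equivalence.from (P⇔ (here refl)) (q , All.lookup x∉ t∈))))
                    (cong suc (length-filter-remove P? Q? u t∈ Qt (P⇔ ∘ there)))
... | no ¬q = trans (cong (suc ∘ length) (filter-reject P? (¬q ∘ proj₁ ∘ Equivalence.to (P⇔ (here refl)))))
                    (length-filter-remove P? Q? u t∈ Qt (P⇔ ∘ there))

-- Matchings in a list of edges

Covered : List (Edge N) → Pred (Fin N) 0ℓ
Covered b w = Any (Incident w) b

covered? : (b : List (Edge N)) → Decidable (Covered b)
covered? b w = any? (incident? w) b

matching? : Decidable (IsMatching {N})
matching? = allPairs? disjoint?

coversAll? : ∀ ws (b : List (Edge N)) → Dec (All (Covered b) ws)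
coversAll? ws b = all? (covered? b) ws

uncovered : List (Edge N) → List (Fin N) → List (Fin N)
uncovered b = filter (¬? ∘ covered? b)

Free : List (Edge N) → Pred (Edge N) 0ℓ
Free b (u , v) = ¬ Covered b u × ¬ Covered b v

free? : (b : List (Edge N)) → Decidable (Free b)
free? b (u , v) = ¬? (covered? b u) ×-dec ¬? (covered? b v)

incident-disjoint : {e f : Edge N} → Disjoint e f → ∀ {w} → Incident w e → ¬ Incident w f
incident-disjoint (¬u , ¬v) (inj₁ refl) = ¬u
incident-disjoint (¬u , ¬v) (inj₂ refl) = ¬v

disjoint⁺ : {e f : Edge N} → (∀ w → Incident w e → ¬ Incident w f) → Disjoint e f
disjoint⁺ ¬i = ¬i _ (inj₁ refl) , ¬i _ (inj₂ refl)

disjoint-sym : {e f : Edge N} → Disjoint e f → Disjoint f e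
disjoint-sym d = disjoint⁺ λ w i i′ → incident-disjoint d i′ i

IsMatching-↭ : {a b : List (Edge N)} → a ↭ b → IsMatching a → IsMatching b
IsMatching-↭ Perm.refl         m                     = m
IsMatching-↭ (Perm.prep e a↭b) (d ∷ m)               = All-resp-↭ a↭b d ∷ IsMatching-↭ a↭b m
IsMatching-↭ (Perm.swap e f a↭b) ((ef ∷ d) ∷ d′ ∷ m) =
  (disjoint-sym ef ∷ All-resp-↭ a↭b d′) ∷ All-resp-↭ a↭b d ∷ IsMatching-↭ a↭b m
IsMatching-↭ (Perm.trans a↭b b↭c)                    = IsMatching-↭ b↭c ∘ IsMatching-↭ a↭b

IsMatching-++⁻ : ∀ (a : List (Edge N)) {b} → IsMatching (a ++ b) → IsMatching a × All (Free a) b × IsMatching b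
IsMatching-++⁻ []      m = [] , All.universal (λ _ → (λ ()) , (λ ())) _ , m
IsMatching-++⁻ (e ∷ a) (d ∷ m) with IsMatching-++⁻ a m | All.++⁻ a d
... | ma , fr , mb | da , db = da ∷ ma , All.zipWith free (db , fr) , mb
  where
  free : ∀ {f} → Disjoint e f × Free a f → Free (e ∷ a) f
  free (ef , ¬u , ¬v) with disjoint-sym ef
  ... | ¬u∈e , ¬v∈e = (λ { (here i) → ¬u∈e i ; (there j) → ¬u j }) ,
                      (λ { (here i) → ¬v∈e i ; (there j) → ¬v j })

IsMatching-++⁺ : ∀ {a b : List (Edge N)} → IsMatching a → All (Free a) b → IsMatching b → IsMatching (a ++ b)
IsMatching-++⁺ []       fr mb = mb
IsMatching-++⁺ (d ∷ ma) fr mb =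
  All.++⁺ d (All.map (λ { (¬u , ¬v) → disjoint-sym (¬u ∘ here , ¬v ∘ here) }) fr)
  ∷ IsMatching-++⁺ ma (All.map (λ { (¬u , ¬v) → ¬u ∘ there , ¬v ∘ there }) fr) mb

covers-++ : ∀ (a b : List (Edge N)) ws → All (Covered (a ++ b)) ws ⇔ All (Covered b) (uncovered a ws)
covers-++ a b ws = mk⇔
  (λ c → All.tabulate λ w∈ → let w∈ws , ¬cov = ∈-filter⁻ (¬? ∘ covered? a) {xs = ws} w∈ in
     [ (λ cov → contradiction cov ¬cov) , id ]′ (Any.++⁻ a (All.lookup c w∈ws)))
  (λ c → All.tabulate λ {w} w∈ → covered w w∈ c)
  where
  covered : ∀ w → w ∈ ws → All (Covered b) (uncovered a ws) → Covered (a ++ b) w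
  covered w w∈ c with covered? a w
  ... | yes cov = Any.++⁺ˡ cov
  ... | no ¬cov = Any.++⁺ʳ a (All.lookup c (∈-filter⁺ (¬? ∘ covered? a) w∈ ¬cov))

Crosses : List (Fin N) → Pred (Edge N) 0ℓ
Crosses ws (u , v) = (u ∈ ws × v ∉ ws) ⊎ (v ∈ ws × u ∉ ws)

-- Each edge takes exactly one vertex of `ws`, and disjointness ensures that no other edge has taken
-- it already.
length-uncovered : ∀ {ws} {b : List (Edge N)} → Unique ws → IsMatching b → All (Crosses ws) b →
                   length (uncovered b ws) + length b ≡ length ws
length-uncovered {ws = ws} uws [] [] =
  trans (ℕ.+-identityʳ _) (cong length (filter-all (¬? ∘ covered? []) (All.universal (λ _ ()) ws)))
length-uncovered {ws = ws} {(u , v) ∷ b} uws (d ∷ m) (cr ∷ crs) =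
  trans (ℕ.+-suc _ (length b)) (trans (cong (_+ length b) (removed cr)) (length-uncovered uws m crs))
  where
  -- `t` is the end of the edge inside `ws` and `o` the end outside; naming them so treats both
  -- orientations at once.
  split : ∀ {x t o} → x ∈ ws → o ∉ ws → (∀ {y} → Incident y (u , v) ⇔ (y ≡ t ⊎ y ≡ o)) →
          (¬ Covered ((u , v) ∷ b) x) ⇔ (¬ Covered b x × x ≢ t)
  split x∈ o∉ inc = mk⇔
    (λ ¬c → ¬c ∘ there , λ x≡t → ¬c (here (Equivalence.from (inc {_}) (inj₁ x≡t))))
    (λ { (¬c , x≢t) (here i) → [ x≢t , (λ { refl → o∉ x∈ }) ]′ (Equivalence.to (inc {_}) i)
       ; (¬c , x≢t) (there c) → ¬c c })
  free : All (Disjoint (u , v)) b → Free b (u , v)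
  free d = (λ c → All.All¬⇒¬Any (All.map proj₁ d) c) , (λ c → All.All¬⇒¬Any (All.map proj₂ d) c)
  remove : ∀ {t} o → t ∈ ws → o ∉ ws → ¬ Covered b t → (∀ {y} → Incident y (u , v) ⇔ (y ≡ t ⊎ y ≡ o)) →
           suc (length (uncovered ((u , v) ∷ b) ws)) ≡ length (uncovered b ws)
  remove o t∈ o∉ ¬c inc = length-filter-remove (¬? ∘ covered? ((u , v) ∷ b)) (¬? ∘ covered? b) uws t∈ ¬c
                          (λ x∈ → split x∈ o∉ λ {y} → inc {y})
  removed : Crosses ws (u , v) → suc (length (uncovered ((u , v) ∷ b) ws)) ≡ length (uncovered b ws)
  removed (inj₁ (u∈ , v∉)) = remove v u∈ v∉ (proj₁ (free d)) (mk⇔ id id)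
  removed (inj₂ (v∈ , u∉)) = remove u v∈ u∉ (proj₂ (free d)) (mk⇔ swap swap)

sized? : ∀ s (b : List (Edge N)) → Dec (IsMatching b × length b ≡ s)
sized? s b = matching? b ×-dec (length b ℕ.≟ s)

matchings : ℕ → List (Edge N) → ℕ
matchings s es = ∑ (subsets es) (λ b → ⟦ sized? s b ⟧)

numMatchings-matchings : ∀ (G : Graph N) s → numMatchings G s ≡ matchings s (edges G)
numMatchings-matchings G s = length-filter-∑ (sized? s) (subsets (edges G))

-- Disjointness is symmetric and length ignores order, so the edges may be listed in whatever order
-- suits the counting.
matchings-↭ : ∀ s {es fs : List (Edge N)} → es ↭ fs → matchings s es ≡ matchings s fs
matchings-↭ s = ∑-subsets-↭ _ λ {a} {b} a↭b → ⟦⟧-cong (sized? s a) (sized? s b) (mk⇔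
  (λ { (m , l) → IsMatching-↭ a↭b m , trans (sym (↭-length a↭b)) l })
  (λ { (m , l) → IsMatching-↭ (Perm.↭-sym a↭b) m , trans (↭-length a↭b) l }))

matchings-0 : ∀ (es : List (Edge N)) → matchings 0 es ≡ 1
matchings-0 []       = refl
matchings-0 (e ∷ es) = trans (∑-subsets-∷ e es _) (cong₂ _+_ (matchings-0 es)
  (∑-zero (subsets es) (λ {b} _ → ⟦⟧-false (sized? 0 (e ∷ b)) λ { (_ , ()) })))

-- Since every edge of es meets us in one vertex, a matching of size s leaves
-- length us ∸ s of the vertices in us free to be joined to w.
module Star {w : Fin N} {us : List (Fin N)} {es : List (Edge N)} (edge : Fin N → Edge N)
  (inc   : ∀ {x u} → Incident x (edge u) ⇔ (x ≡ w ⊎ x ≡ u))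
  (uus   : Unique us)
  (¬w    : ∀ {e} → e ∈ es → ¬ Incident w e)
  (cross : ∀ {e} → e ∈ es → Crosses us e)
  where

  size : ∀ {b} → b ∈ subsets es → IsMatching b → length (uncovered b us) + length b ≡ length us
  size b∈ m = length-uncovered uus m (All.map cross (subsets-⊆ es b∈))

  -- Each edge of a matching occupies its own vertex of `us`. This is what reconciles truncated
  -- subtraction with the integer coefficient.
  matchings-large : ∀ {s} → length us < s → matchings s es ≡ 0
  matchings-large {s} us<s = ∑-zero (subsets es) λ {b} b∈ → ⟦⟧-false (sized? s b) λ
    { (m , refl) → ℕ.<⇒≱ us<s (subst (length b ≤_) (size b∈ m) (ℕ.m≤n+m (length b) _)) }

  private
    -- No edge of `b` meets `w`, so the only possible conflict with `edge u` is at `u`.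
    single : ∀ {u b} → b ∈ subsets es → IsMatching (edge u ∷ b) ⇔ (IsMatching b × ¬ Covered b u)
    single {u} {b} b∈ = mk⇔
      (λ { (d ∷ m) → m , λ c → let de , i = All.lookupAny d c in
             incident-disjoint de (Equivalence.from (inc {u}) (inj₂ refl)) i })
      (λ { (m , ¬c) → All.tabulate (λ e∈ → disjoint⁺ λ x i i′ →
             [ (λ { refl → ¬w (All.lookup (subsets-⊆ es b∈) e∈) i′ })
             , (λ { refl → ¬c (lose e∈ i′) }) ]′ (Equivalence.to (inc {x} {u}) i)) ∷ m })

  matchings-star : ∀ s → matchings (suc s) (map edge us ++ es)
                       ≡ matchings (suc s) es + (length us ∸ s) * matchings s es
  matchings-star s = begin
    matchings (suc s) (map edge us ++ es)
      ≡⟨ ∑-subsets-++ (map edge us) es _ ⟩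
    ∑ (subsets (map edge us)) f
      ≡⟨ ∑-subsets-sparse (map edge us) f sparse ⟩
    matchings (suc s) es + ∑ (map edge us) (λ e → f (e ∷ []))
      ≡⟨ cong (matchings (suc s) es +_) (begin
        ∑ (map edge us) (λ e → f (e ∷ []))
          ≡⟨ ∑-map edge us _ ⟩
        ∑ us (λ u → ∑ (subsets es) (λ b → ⟦ sized? (suc s) (edge u ∷ b) ⟧))
          ≡⟨ ∑-cong us (λ {u} _ → ∑-cong (subsets es) (λ {b} b∈ → begin
               ⟦ sized? (suc s) (edge u ∷ b) ⟧
                 ≡⟨ ⟦⟧-cong (sized? (suc s) (edge u ∷ b))
                            (sized? s b ×-dec ¬? (covered? b u))
                            (mk⇔ (λ { (m , refl) → let m , ¬c = Equivalence.to (single b∈) m in (m , refl) , ¬c })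
                                 (λ { ((m , refl) , ¬c) → Equivalence.from (single b∈) (m , ¬c) , refl })) ⟩
               ⟦ sized? s b ×-dec ¬? (covered? b u) ⟧
                 ≡⟨ ⟦⟧-× (sized? s b) (¬? (covered? b u)) ⟩
               g b * ⟦ ¬? (covered? b u) ⟧ ∎)) ⟩
        ∑ us (λ u → ∑ (subsets es) (λ b → g b * ⟦ ¬? (covered? b u) ⟧))
          -- With `b` fixed, the sum over `u` counts the vertices of `us` that `b` leaves uncovered,
          -- a number that depends on the size of `b` alone.
          ≡⟨ ∑-swap us (subsets es) _ ⟩
        ∑ (subsets es) (λ b → ∑ us (λ u → g b * ⟦ ¬? (covered? b u) ⟧))
          ≡⟨ ∑-cong (subsets es) (λ {b} b∈ → begin
               ∑ us (λ u → g b * ⟦ ¬? (covered? b u) ⟧)  ≡⟨ ∑-*ˡ (g b) us _ ⟩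
               g b * ∑ us (λ u → ⟦ ¬? (covered? b u) ⟧)
                 ≡⟨ cong (g b *_) (length-filter-∑ (¬? ∘ covered? b) us) ⟨
               g b * length (uncovered b us)
                 -- `size` speaks of matchings only; for every other `b` the factor `g b` is 0.
                 ≡⟨ ⟦⟧-*-cong (sized? s b) (λ { (m , refl) →
                      trans (sym (ℕ.m+n∸n≡m _ (length b))) (cong (_∸ length b) (size b∈ m)) }) ⟩
               g b * (length us ∸ s)                     ∎) ⟩
        ∑ (subsets es) (λ b → g b * (length us ∸ s))
          ≡⟨ ∑-*ʳ (length us ∸ s) (subsets es) g ⟩
        matchings s es * (length us ∸ s)
          ≡⟨ ℕ.*-comm (matchings s es) _ ⟩
        (length us ∸ s) * matchings s es ∎) ⟩
    matchings (suc s) es + (length us ∸ s) * matchings s es ∎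
    where
    open ≡-Reasoning
    f : List (Edge N) → ℕ
    f a = ∑ (subsets es) (λ b → ⟦ sized? (suc s) (a ++ b) ⟧)
    g : List (Edge N) → ℕ
    g b = ⟦ sized? s b ⟧
    through-w : ∀ {e} → e ∈ map edge us → Incident w e
    through-w e∈ with ∈-map⁻ edge e∈
    ... | _ , _ , refl = Equivalence.from (inc {w}) (inj₁ refl)
    sparse : ∀ {d e} → d ∈ map edge us → e ∈ map edge us → ∀ a → f (d ∷ e ∷ a) ≡ 0
    sparse {d} {e} d∈ e∈ a = ∑-zero (subsets es) λ {b} _ → ⟦⟧-false (sized? (suc s) (d ∷ e ∷ a ++ b)) λ
      { (((de ∷ _) ∷ _) , _) → incident-disjoint de (through-w d∈) (through-w e∈) }

-- The complete graph on a list of vertices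

pairs : List A → List (A × A)
pairs []       = []
pairs (w ∷ ws) = map (w ,_) ws ++ pairs ws

∈-pairs⁻ : ∀ (ws : List A) {u v} → (u , v) ∈ pairs ws → u ∈ ws × v ∈ ws
∈-pairs⁻ (w ∷ ws) e∈ with ∈-++⁻ (map (w ,_) ws) e∈
... | inj₂ e∈ = let u∈ , v∈ = ∈-pairs⁻ ws e∈ in there u∈ , there v∈
... | inj₁ e∈ with ∈-map⁻ (w ,_) e∈
...   | _ , v∈ , refl = here refl , there v∈

module _ {ℓ} {_<_ : Rel A ℓ} where

  ∈-pairs⁻-< : ∀ {ws u v} → AllPairs _<_ ws → (u , v) ∈ pairs ws → u < v
  ∈-pairs⁻-< {w ∷ ws} (w< ∷ s) e∈ with ∈-++⁻ (map (w ,_) ws) e∈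
  ... | inj₂ e∈ = ∈-pairs⁻-< s e∈
  ... | inj₁ e∈ with ∈-map⁻ (w ,_) e∈
  ...   | _ , v∈ , refl = All.lookup w< v∈

  -- In a sorted list the order of positions is that of `_<_`; asymmetry refutes the cases in which
  -- `v` does not come after `u`.
  ∈-pairs⁺ : (∀ {u v} → u < v → ¬ v < u) → ∀ {ws u v} → AllPairs _<_ ws →
             u ∈ ws → v ∈ ws → u < v → (u , v) ∈ pairs ws
  ∈-pairs⁺ asym {w ∷ ws} (w< ∷ s) (here refl) (here refl) u<v = contradiction u<v (asym u<v)
  ∈-pairs⁺ asym {w ∷ ws} (w< ∷ s) (here refl) (there v∈)  u<v = ∈-++⁺ˡ (∈-map⁺ (w ,_) v∈)
  ∈-pairs⁺ asym {w ∷ ws} (w< ∷ s) (there u∈)  (here refl) u<v = contradiction u<v (asym (All.lookup w< u∈))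
  ∈-pairs⁺ asym {w ∷ ws} (w< ∷ s) (there u∈)  (there v∈)  u<v = ∈-++⁺ʳ (map (w ,_) ws) (∈-pairs⁺ asym s u∈ v∈ u<v)

pairs-unique : ∀ {ws : List A} → Unique ws → Unique (pairs ws)
pairs-unique []                 = []
pairs-unique {ws = w ∷ ws} (w∉ ∷ u) = Unique.++⁺ (Unique.map⁺ (λ { refl → refl }) u) (pairs-unique u) disj
  where
  disj : ∀ {e} → ¬ (e ∈ map (w ,_) ws × e ∈ pairs ws)
  disj (e∈ , e∈′) with ∈-map⁻ (w ,_) e∈
  ... | _ , _ , refl = All.lookup w∉ (proj₁ (∈-pairs⁻ ws e∈′)) refl

module _ {P : Pred A 0ℓ} (P? : Decidable P) where

  both? : Decidable (λ ((u , v) : A × A) → P u × P v)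
  both? (u , v) = P? u ×-dec P? v

  -- An induced subgraph of a complete graph is complete: the clique edges that avoid a matching are
  -- all the pairs of uncovered vertices.
  pairs-filter : ∀ ws → filter both? (pairs ws) ≡ pairs (filter P? ws)
  pairs-filter []       = refl
  pairs-filter (w ∷ ws) = trans (filter-++ both? (map (w ,_) ws) (pairs ws)) (step (P? w))
    where
    accept : P w → ∀ us → filter both? (map (w ,_) us) ≡ map (w ,_) (filter P? us)
    accept pw []       = refl
    accept pw (u ∷ us) = by (P? u)
      where
      by : Dec (P u) → filter both? (map (w ,_) (u ∷ us)) ≡ map (w ,_) (filter P? (u ∷ us))
      by (yes pu) = trans (filter-accept both? (pw , pu))
        (trans (cong ((w , u) ∷_) (accept pw us)) (cong (map (w ,_)) (sym (filter-accept P? pu))))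
      by (no ¬pu) = trans (filter-reject both? (¬pu ∘ proj₂))
        (trans (accept pw us) (cong (map (w ,_)) (sym (filter-reject P? ¬pu))))
    step : Dec (P w) → filter both? (map (w ,_) ws) ++ filter both? (pairs ws) ≡ pairs (filter P? (w ∷ ws))
    step (yes pw) = trans (cong₂ _++_ (accept pw ws) (pairs-filter ws)) (cong pairs (sym (filter-accept P? pw)))
    step (no ¬pw) = trans
      (cong₂ _++_ (filter-none both? (All.map⁺ (All.universal (λ _ → ¬pw ∘ proj₁) ws))) (pairs-filter ws))
      (cong pairs (sym (filter-reject P? ¬pw)))

perfect? : ∀ ws (b : List (Edge N)) → Dec (IsMatching b × All (Covered b) ws)
perfect? ws b = matching? b ×-dec coversAll? ws b

perfects : List (Fin N) → ℕ
perfects ws = ∑ (subsets (pairs ws)) (λ b → ⟦ perfect? ws b ⟧)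

-- Completing a matching `a` means avoiding the vertices of `a`, which confines `b` to the clique on
-- the uncovered vertices, and covering all of these. If `a` is no matching, both sides are 0.
∑-perfect-++ : ∀ ws (a : List (Edge N)) →
  ∑ (subsets (pairs ws)) (λ b → ⟦ perfect? ws (a ++ b) ⟧) ≡ ⟦ matching? a ⟧ * perfects (uncovered a ws)
∑-perfect-++ ws a = begin
  ∑ (subsets (pairs ws)) (λ b → ⟦ perfect? ws (a ++ b) ⟧)
    ≡⟨ ∑-cong (subsets (pairs ws)) (λ {b} _ → begin
         ⟦ perfect? ws (a ++ b) ⟧
           ≡⟨ ⟦⟧-cong (perfect? ws (a ++ b))
                      (matching? a ×-dec (all? (free? a) b ×-dec perfect? (uncovered a ws) b))
                (mk⇔ (λ { (m , c) → let ma , f , mb = IsMatching-++⁻ a m in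
                            ma , f , mb , Equivalence.to (covers-++ a b ws) c })
                     (λ { (ma , f , mb , c) → IsMatching-++⁺ ma f mb , Equivalence.from (covers-++ a b ws) c })) ⟩
         ⟦ matching? a ×-dec (all? (free? a) b ×-dec perfect? (uncovered a ws) b) ⟧
           ≡⟨ ⟦⟧-× (matching? a) (all? (free? a) b ×-dec perfect? (uncovered a ws) b) ⟩
         ⟦ matching? a ⟧ * ⟦ all? (free? a) b ×-dec perfect? (uncovered a ws) b ⟧
           ≡⟨ cong (⟦ matching? a ⟧ *_) (⟦⟧-× (all? (free? a) b) (perfect? (uncovered a ws) b)) ⟩
         ⟦ matching? a ⟧ * (⟦ all? (free? a) b ⟧ * ⟦ perfect? (uncovered a ws) b ⟧) ∎) ⟩
  ∑ (subsets (pairs ws)) (λ b → ⟦ matching? a ⟧ * (⟦ all? (free? a) b ⟧ * ⟦ perfect? (uncovered a ws) b ⟧))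
    ≡⟨ ∑-*ˡ ⟦ matching? a ⟧ (subsets (pairs ws)) _ ⟩
  ⟦ matching? a ⟧ * ∑ (subsets (pairs ws)) (λ b → ⟦ all? (free? a) b ⟧ * ⟦ perfect? (uncovered a ws) b ⟧)
    ≡⟨ cong (⟦ matching? a ⟧ *_) (∑-subsets-filter (free? a) (pairs ws) _) ⟩
  ⟦ matching? a ⟧ * ∑ (subsets (filter (free? a) (pairs ws))) (λ b → ⟦ perfect? (uncovered a ws) b ⟧)
    ≡⟨ cong (λ es → ⟦ matching? a ⟧ * ∑ (subsets es) (λ b → ⟦ perfect? (uncovered a ws) b ⟧))
            (pairs-filter (¬? ∘ covered? a) ws) ⟩
  ⟦ matching? a ⟧ * perfects (uncovered a ws) ∎
  where open ≡-Reasoning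

-- The double factorial (t - 1)!! for even t and 0 for odd t, in the form of the recurrence by the
-- partner of a fixed vertex.
numPerfect : ℕ → ℕ
numPerfect 0             = 1
numPerfect 1             = 0
numPerfect (suc (suc t)) = suc t * numPerfect t

-- The first vertex has a partner among the others, and deleting both leaves a complete graph on two
-- vertices fewer. The remaining vertices need not form a tail of the list, hence the recursion on
-- the length.
perfects-length : ∀ {ws : List (Fin N)} → Unique ws → perfects ws ≡ numPerfect (length ws)
perfects-length u = go _ u refl
  where
  open ≡-Reasoning
  go : ∀ t {ws : List (Fin N)} → Unique ws → length ws ≡ t → perfects ws ≡ numPerfect t
  go 0             {[]}         _        _    = refl
  go 1             {w ∷ []}     _        _    = refl
  go (suc (suc t)) {w ∷ ws}     (w∉ ∷ u) len = begin
    ∑ (subsets (map (w ,_) ws ++ pairs ws)) (λ b → ⟦ perfect? (w ∷ ws) b ⟧)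
      ≡⟨ ∑-subsets-++ (map (w ,_) ws) (pairs ws) _ ⟩
    ∑ (subsets (map (w ,_) ws)) f
      ≡⟨ ∑-subsets-sparse (map (w ,_) ws) f sparse ⟩
    f [] + ∑ (map (w ,_) ws) (λ e → f (e ∷ []))
      -- Without an edge from the star at `w` nothing covers `w`, because `pairs ws` avoids it.
      ≡⟨ cong₂ _+_ (∑-zero (subsets (pairs ws)) (λ {b} b∈ → ⟦⟧-false (perfect? (w ∷ ws) b) λ
           { (_ , c ∷ _) → let e∈ , i = All.lookupAny (subsets-⊆ (pairs ws) b∈) c in avoid e∈ i }))
           (∑-map (w ,_) ws _) ⟩
    ∑ ws (λ u → f ((w , u) ∷ []))
      ≡⟨ ∑-cong ws single ⟩
    ∑ ws (λ _ → numPerfect t)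
      ≡⟨ ∑-const ws _ ⟩
    length ws * numPerfect t
      ≡⟨ cong (_* numPerfect t) (ℕ.suc-injective len) ⟩
    suc t * numPerfect t ∎
    where
    f : List (Edge _) → ℕ
    f a = ∑ (subsets (pairs ws)) (λ b → ⟦ perfect? (w ∷ ws) (a ++ b) ⟧)
    avoid : ∀ {e} → e ∈ pairs ws → ¬ Incident w e
    avoid {u , v} e∈ (inj₁ refl) = All.lookup w∉ (proj₁ (∈-pairs⁻ ws e∈)) refl
    avoid {u , v} e∈ (inj₂ refl) = All.lookup w∉ (proj₂ (∈-pairs⁻ ws e∈)) refl
    through-w : ∀ {e} → e ∈ map (w ,_) ws → Incident w e
    through-w e∈ with ∈-map⁻ (w ,_) e∈
    ... | _ , _ , refl = inj₁ refl
    sparse : ∀ {d e} → d ∈ map (w ,_) ws → e ∈ map (w ,_) ws → ∀ a → f (d ∷ e ∷ a) ≡ 0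
    sparse {d} {e} d∈ e∈ a = ∑-zero (subsets (pairs ws)) λ {b} _ → ⟦⟧-false (perfect? (w ∷ ws) (d ∷ e ∷ a ++ b)) λ
      { (((de ∷ _) ∷ _) , _) → incident-disjoint de (through-w d∈) (through-w e∈) }
    single : ∀ {u} → u ∈ ws → f ((w , u) ∷ []) ≡ numPerfect t
    single {v} v∈ = begin
      f ((w , v) ∷ [])
        ≡⟨ ∑-cong (subsets (pairs ws)) (λ {b} _ → ⟦⟧-cong (perfect? (w ∷ ws) ((w , v) ∷ b)) (perfect? ws ((w , v) ∷ b))
             (mk⇔ (λ { (m , c) → m , All.tail c }) (λ { (m , c) → m , here (inj₁ refl) ∷ c }))) ⟩
      ∑ (subsets (pairs ws)) (λ b → ⟦ perfect? ws ((w , v) ∷ b) ⟧)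
        ≡⟨ ∑-perfect-++ ws ((w , v) ∷ []) ⟩
      1 * perfects (uncovered ((w , v) ∷ []) ws)
        ≡⟨ ℕ.*-identityˡ _ ⟩
      perfects (uncovered ((w , v) ∷ []) ws)
        ≡⟨ go t (Unique.filter⁺ (¬? ∘ covered? ((w , v) ∷ [])) u) (ℕ.suc-injective (begin
             suc (length (uncovered ((w , v) ∷ []) ws)) ≡⟨ ℕ.+-comm 1 _ ⟩
             length (uncovered ((w , v) ∷ []) ws) + 1
               -- The edge `(w , v)` has only `v` in `ws`, so it crosses `ws` and uses up exactly
               -- one of its vertices.
               ≡⟨ length-uncovered u ([] ∷ []) (inj₂ (v∈ , λ w∈ → All.lookup w∉ w∈ refl) ∷ []) ⟩
             length ws                                 ≡⟨ ℕ.suc-injective len ⟩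
             suc t                                     ∎)) ⟩
      numPerfect t ∎

-- Two cliques joined by crossing edges

module _ {xs ys : List (Fin N)} (uxs : Unique xs) (uys : Unique ys) (disj : ∀ {w} → w ∈ xs → w ∉ ys) where

  private
    within : ∀ {zs} {b : List (Edge N)} → b ∈ subsets (pairs zs) → ∀ {w} → Covered b w → w ∈ zs
    within {zs = zs} b∈ c = let e∈ , i = All.lookupAny (subsets-⊆ (pairs zs) b∈) c in incident⇒∈ e∈ i
      where
      incident⇒∈ : ∀ {w e} → e ∈ pairs zs → Incident w e → w ∈ zs
      incident⇒∈ e∈ (inj₁ refl) = proj₁ (∈-pairs⁻ zs e∈)
      incident⇒∈ e∈ (inj₂ refl) = proj₂ (∈-pairs⁻ zs e∈)

  -- Edges inside `xs` never meet edges inside `ys`, so once `a` is chosen the two sides are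
  -- completed independently. Both factors contain the condition that `a` is a matching.
  perfect-split : ∀ a {x y} → x ∈ subsets (pairs xs) → y ∈ subsets (pairs ys) →
    ⟦ perfect? (xs ++ ys) (a ++ x ++ y) ⟧ ≡ ⟦ perfect? xs (a ++ x) ⟧ * ⟦ perfect? ys (a ++ y) ⟧
  perfect-split a {x} {y} x∈ y∈ = trans
    (⟦⟧-cong (perfect? (xs ++ ys) (a ++ x ++ y)) (perfect? xs (a ++ x) ×-dec perfect? ys (a ++ y)) (mk⇔ to from))
    (⟦⟧-× (perfect? xs (a ++ x)) (perfect? ys (a ++ y)))
    where
    free : ∀ {e} → e ∈ pairs ys → Free x e
    free e∈ = let u∈ , v∈ = ∈-pairs⁻ ys e∈ in
      (λ c → disj (within x∈ c) u∈) , (λ c → disj (within x∈ c) v∈)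
    to : IsMatching (a ++ x ++ y) × All (Covered (a ++ x ++ y)) (xs ++ ys) →
         (IsMatching (a ++ x) × All (Covered (a ++ x)) xs) × (IsMatching (a ++ y) × All (Covered (a ++ y)) ys)
    to (m , c) =
      let ma , f , mxy = IsMatching-++⁻ a m
          mx , _ , my = IsMatching-++⁻ x mxy
          fx , fy = All.++⁻ x f
          cx , cy = All.++⁻ xs c
      in (IsMatching-++⁺ ma fx mx , All.tabulate λ w∈ → [ Any.++⁺ˡ , (λ c′ →
           [ Any.++⁺ʳ a , (λ cy → contradiction (within y∈ cy) (disj w∈)) ]′ (Any.++⁻ x c′)) ]′
           (Any.++⁻ a (All.lookup cx w∈)))
       , (IsMatching-++⁺ ma fy my , All.tabulate λ w∈ → [ Any.++⁺ˡ , (λ c′ →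
           [ (λ cx → contradiction w∈ (disj (within x∈ cx))) , Any.++⁺ʳ a ]′ (Any.++⁻ x c′)) ]′
           (Any.++⁻ a (All.lookup cy w∈)))
    from : (IsMatching (a ++ x) × All (Covered (a ++ x)) xs) × (IsMatching (a ++ y) × All (Covered (a ++ y)) ys) →
           IsMatching (a ++ x ++ y) × All (Covered (a ++ x ++ y)) (xs ++ ys)
    from ((max , cx) , (may , cy)) =
      let ma , fx , mx = IsMatching-++⁻ a max
          _  , fy , my = IsMatching-++⁻ a may
      in IsMatching-++⁺ ma (All.++⁺ fx fy) (IsMatching-++⁺ mx (All.map free (subsets-⊆ (pairs ys) y∈)) my)
       , All.++⁺ (All.map (λ c → [ Any.++⁺ˡ , Any.++⁺ʳ a ∘ Any.++⁺ˡ ]′ (Any.++⁻ a c)) cx)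
                 (All.map (λ c → [ Any.++⁺ˡ , Any.++⁺ʳ a ∘ Any.++⁺ʳ x ]′ (Any.++⁻ a c)) cy)

  module _ {es : List (Edge N)} (crossˣ : ∀ {e} → e ∈ es → Crosses xs e) (crossʸ : ∀ {e} → e ∈ es → Crosses ys e) where

    -- Terms beyond the minimum vanish, since a matching of crossing edges takes a vertex of each
    -- clique for every edge. The freedom in `k` serves both the formula, which stops at the
    -- minimum, and the program, which stops at `n`.
    perfects-cliques : ∀ {k} → length xs ⊓ length ys ≤ k →
      ∑ (subsets (es ++ pairs xs ++ pairs ys)) (λ b → ⟦ perfect? (xs ++ ys) b ⟧)
      ≡ ∑ (upTo (suc k)) (λ s → matchings s es * numPerfect (length xs ∸ s) * numPerfect (length ys ∸ s))
    perfects-cliques {k} ⊓≤k = begin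
      ∑ (subsets (es ++ pairs xs ++ pairs ys)) (λ b → ⟦ perfect? (xs ++ ys) b ⟧)
        ≡⟨ ∑-subsets-++ es (pairs xs ++ pairs ys) _ ⟩
      ∑ (subsets es) (λ a → ∑ (subsets (pairs xs ++ pairs ys)) (λ b → ⟦ perfect? (xs ++ ys) (a ++ b) ⟧))
        ≡⟨ ∑-cong (subsets es) by-size ⟩
      ∑ (subsets es) (λ a → ∑ (upTo (suc k)) (λ s → ⟦ sized? s a ⟧ * h s))
        ≡⟨ ∑-swap (subsets es) (upTo (suc k)) _ ⟩
      ∑ (upTo (suc k)) (λ s → ∑ (subsets es) (λ a → ⟦ sized? s a ⟧ * h s))
        ≡⟨ ∑-cong (upTo (suc k)) (λ {s} _ → trans (∑-*ʳ (h s) (subsets es) _) (sym (ℕ.*-assoc (matchings s es) _ _))) ⟩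
      ∑ (upTo (suc k)) (λ s → matchings s es * numPerfect (length xs ∸ s) * numPerfect (length ys ∸ s)) ∎
      where
      open ≡-Reasoning
      h : ℕ → ℕ
      h s = numPerfect (length xs ∸ s) * numPerfect (length ys ∸ s)
      size : ∀ {zs} → Unique zs → (∀ {e} → e ∈ es → Crosses zs e) → ∀ {a} → a ∈ subsets es → IsMatching a →
             length (uncovered a zs) + length a ≡ length zs
      size u cross a∈ m = length-uncovered u m (All.map cross (subsets-⊆ es a∈))
      rest : ∀ {zs} → Unique zs → (∀ {e} → e ∈ es → Crosses zs e) → ∀ {a} → a ∈ subsets es → IsMatching a →
             perfects (uncovered a zs) ≡ numPerfect (length zs ∸ length a)
      rest u cross {a} a∈ m = trans (perfects-length (Unique.filter⁺ (¬? ∘ covered? a) u))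
        (cong numPerfect (trans (sym (ℕ.m+n∸n≡m _ (length a))) (cong (_∸ length a) (size u cross a∈ m))))
      bound : ∀ {a} → a ∈ subsets es → IsMatching a → length a < suc k
      bound {a} a∈ m = s≤s (ℕ.≤-trans (ℕ.⊓-glb
        (subst (length a ≤_) (size uxs crossˣ a∈ m) (ℕ.m≤n+m (length a) _))
        (subst (length a ≤_) (size uys crossʸ a∈ m) (ℕ.m≤n+m (length a) _))) ⊓≤k)
      merge : ∀ i j k → (i * j) * (i * k) ≡ (i * i) * (j * k)
      merge = solve-∀
      by-size : ∀ {a} → a ∈ subsets es →
        ∑ (subsets (pairs xs ++ pairs ys)) (λ b → ⟦ perfect? (xs ++ ys) (a ++ b) ⟧)
        ≡ ∑ (upTo (suc k)) (λ s → ⟦ sized? s a ⟧ * h s)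
      by-size {a} a∈ = begin
        ∑ (subsets (pairs xs ++ pairs ys)) (λ b → ⟦ perfect? (xs ++ ys) (a ++ b) ⟧)
          ≡⟨ ∑-subsets-++ (pairs xs) (pairs ys) _ ⟩
        ∑ (subsets (pairs xs)) (λ x → ∑ (subsets (pairs ys)) (λ y → ⟦ perfect? (xs ++ ys) (a ++ x ++ y) ⟧))
          ≡⟨ ∑-cong (subsets (pairs xs)) (λ x∈ → ∑-cong (subsets (pairs ys)) (λ y∈ → perfect-split a x∈ y∈)) ⟩
        ∑ (subsets (pairs xs)) (λ x → ∑ (subsets (pairs ys)) (λ y → ⟦ perfect? xs (a ++ x) ⟧ * ⟦ perfect? ys (a ++ y) ⟧))
          ≡⟨ ∑-* (subsets (pairs xs)) (subsets (pairs ys)) _ _ ⟩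
        ∑ (subsets (pairs xs)) (λ x → ⟦ perfect? xs (a ++ x) ⟧) * ∑ (subsets (pairs ys)) (λ y → ⟦ perfect? ys (a ++ y) ⟧)
          ≡⟨ cong₂ _*_ (∑-perfect-++ xs a) (∑-perfect-++ ys a) ⟩
        (⟦ matching? a ⟧ * perfects (uncovered a xs)) * (⟦ matching? a ⟧ * perfects (uncovered a ys))
          ≡⟨ merge ⟦ matching? a ⟧ _ _ ⟩
        (⟦ matching? a ⟧ * ⟦ matching? a ⟧) * (perfects (uncovered a xs) * perfects (uncovered a ys))
          -- Each clique contributed one copy of the indicator of `a`.
          ≡⟨ cong (_* (perfects (uncovered a xs) * perfects (uncovered a ys))) (⟦⟧-idem (matching? a)) ⟩
        ⟦ matching? a ⟧ * (perfects (uncovered a xs) * perfects (uncovered a ys))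
          -- By `bound` the size of a matching `a` is among the summation indices, so the sum over
          -- `s` picks out the term at `length a`. This sorts the matchings by size.
          ≡⟨ ⟦⟧-*-cong (matching? a) (λ m → trans
               (cong₂ _*_ (rest uxs crossˣ a∈ m) (rest uys crossʸ a∈ m))
               (sym (∑-upTo-indicator (suc k) (length a) h (bound a∈ m)))) ⟩
        ⟦ matching? a ⟧ * ∑ (upTo (suc k)) (λ s → ⟦ length a ℕ.≟ s ⟧ * h s)
          ≡⟨ ∑-*ˡ ⟦ matching? a ⟧ (upTo (suc k)) _ ⟨
        ∑ (upTo (suc k)) (λ s → ⟦ matching? a ⟧ * (⟦ length a ℕ.≟ s ⟧ * h s))
          ≡⟨ ∑-cong (upTo (suc k)) (λ {s} _ → trans (sym (ℕ.*-assoc ⟦ matching? a ⟧ ⟦ length a ℕ.≟ s ⟧ (h s)))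
               (cong (_* h s) (sym (⟦⟧-× (matching? a) (length a ℕ.≟ s))))) ⟩
        ∑ (upTo (suc k)) (λ s → ⟦ sized? s a ⟧ * h s) ∎

-- Graphs

elements : Subset N → List (Fin N)
elements []            = []
elements (inside  ∷ S) = zero ∷ map suc (elements S)
elements (outside ∷ S) = map suc (elements S)

length-elements : ∀ (S : Subset N) → length (elements S) ≡ Subset.∣ S ∣
length-elements []            = refl
length-elements (inside  ∷ S) = cong suc (trans (length-map suc (elements S)) (length-elements S))
length-elements (outside ∷ S) = trans (length-map suc (elements S)) (length-elements S)

∈-elements⁺ : ∀ {S : Subset N} {u} → u Subset.∈ S → u ∈ elements S
∈-elements⁺ Vec.here                          = here refl
∈-elements⁺ {S = inside  ∷ S} (Vec.there u∈S) = there (∈-map⁺ suc (∈-elements⁺ u∈S))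
∈-elements⁺ {S = outside ∷ S} (Vec.there u∈S) = ∈-map⁺ suc (∈-elements⁺ u∈S)

∈-elements⁻ : ∀ (S : Subset N) {u} → u ∈ elements S → u Subset.∈ S
∈-elements⁻ (inside  ∷ S) (here refl) = Vec.here
∈-elements⁻ (inside  ∷ S) (there u∈) with ∈-map⁻ suc u∈
... | v , v∈ , refl = Vec.there (∈-elements⁻ S v∈)
∈-elements⁻ (outside ∷ S) u∈ with ∈-map⁻ suc u∈
... | v , v∈ , refl = Vec.there (∈-elements⁻ S v∈)

-- Increasing order makes `pairs (elements S)` list every edge with its smaller end first, as
-- `edges` does.
elements-sorted : ∀ (S : Subset N) → AllPairs Fin._<_ (elements S)
elements-sorted []            = []
elements-sorted (inside  ∷ S) =
  All.map⁺ (All.universal (λ _ → s≤s z≤n) _) ∷ AllPairs.map⁺ (AllPairs.map s≤s (elements-sorted S))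
elements-sorted (outside ∷ S) = AllPairs.map⁺ (AllPairs.map s≤s (elements-sorted S))

sorted⇒unique : ∀ {ws : List (Fin N)} → AllPairs Fin._<_ ws → Unique ws
sorted⇒unique = AllPairs.map Fin.<⇒≢

elements-unique : ∀ (S : Subset N) → Unique (elements S)
elements-unique S = sorted⇒unique (elements-sorted S)

∈-edges⁺ : ∀ (G : Graph N) {u v} → u Fin.< v → Adj G u v → (u , v) ∈ edges G
∈-edges⁺ G {u} {v} u<v adj =
  ∈-filter⁺ _ (∈-cartesianProduct⁺ (∈-allFin u) (∈-allFin v)) (u<v , adj)

∈-edges⁻ : ∀ (G : Graph N) {u v} → (u , v) ∈ edges G → u Fin.< v × Adj G u v
∈-edges⁻ {N} G e∈ = proj₂ (∈-filter⁻ _ {xs = cartesianProduct (allFin N) (allFin N)} e∈)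

edges-unique : ∀ (G : Graph N) → Unique (edges G)
edges-unique {N} G = Unique.filter⁺ _ (Unique.cartesianProduct⁺ (Unique.allFin⁺ N) (Unique.allFin⁺ N))

∈-𝒩⁺ : ∀ (G : Graph N) {u v} → Adj G u v → v Subset.∈ 𝒩 G u
∈-𝒩⁺ G {u} {v} adj = Vec.lookup⇒[]= v (𝒩 G u)
  (trans (Vec.lookup∘tabulate _ v) (dec-true (adj? G u v) adj))

∈-𝒩⁻ : ∀ (G : Graph N) {u v} → v Subset.∈ 𝒩 G u → Adj G u v
∈-𝒩⁻ G {u} {v} v∈ with adj? G u v | trans (sym (Vec.lookup∘tabulate (λ v → does (adj? G u v)) v)) (Vec.[]=⇒lookup v∈)
... | yes adj | _ = adj

-- Frees `p` from the fixed order of `edges` and from the vertex set as a subset, so that both can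
-- be split along X and Y.
p-perfect : ∀ (G : Graph N) {es} ws → edges G ↭ es → (∀ {w} → w Subset.∈ V G ⇔ w ∈ ws) →
            p G ≡ ∑ (subsets es) (λ b → ⟦ perfect? ws b ⟧)
p-perfect G {es} ws G↭es V⇔ws = begin
  p G
    ≡⟨ length-filter-∑ (λ b → matching? b ×-dec covers? G b) (subsets (edges G)) ⟩
  ∑ (subsets (edges G)) (λ b → ⟦ matching? b ×-dec covers? G b ⟧)
    ≡⟨ ∑-cong (subsets (edges G)) (λ {b} _ → ⟦⟧-cong (matching? b ×-dec covers? G b) (perfect? ws b) (mk⇔
         (λ { (m , c) → m , All.tabulate (λ w∈ → c _ (Equivalence.from V⇔ws w∈)) })
         (λ { (m , c) → m , λ w w∈ → All.lookup c (Equivalence.to V⇔ws w∈) }))) ⟩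
  ∑ (subsets (edges G)) (λ b → ⟦ perfect? ws b ⟧)
    ≡⟨ ∑-subsets-↭ _ (λ {a} {b} a↭b → ⟦⟧-cong (perfect? ws a) (perfect? ws b) (mk⇔
         (λ { (m , c) → IsMatching-↭ a↭b m , All.map (Any-resp-↭ a↭b) c })
         (λ { (m , c) → IsMatching-↭ (Perm.↭-sym a↭b) m , All.map (Any-resp-↭ (Perm.↭-sym a↭b)) c }))) G↭es ⟩
  ∑ (subsets es) (λ b → ⟦ perfect? ws b ⟧) ∎
  where open ≡-Reasoning

p-K : ∀ t → p (K t) ≡ numPerfect t
p-K t = begin
  p (K t)                      ≡⟨ p-perfect (K t) (allFin t) K↭ (mk⇔ (λ _ → ∈-allFin _) (λ _ → Subset.∈⊤)) ⟩
  perfects (allFin t)          ≡⟨ perfects-length (Unique.allFin⁺ t) ⟩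
  numPerfect (length (allFin t)) ≡⟨ cong numPerfect (length-tabulate {n = t} id) ⟩
  numPerfect t                 ∎
  where
  open ≡-Reasoning
  sorted : AllPairs Fin._<_ (allFin t)
  sorted = AllPairs.tabulate⁺-< id
  K↭ : edges (K t) ↭ pairs (allFin t)
  K↭ = unique∧set⇒↭ (edges-unique (K t)) (pairs-unique (Unique.allFin⁺ t)) (mk⇔
    (λ e∈ → ∈-pairs⁺ Fin.<-asym sorted (∈-allFin _) (∈-allFin _) (proj₁ (∈-edges⁻ (K t) e∈)))
    (λ e∈ → let u<v = ∈-pairs⁻-< sorted e∈ in ∈-edges⁺ (K t) u<v (Fin.<⇒≢ u<v)))

-- The complement of a chain graph

module CoChainProperties {n m} (C : CoChain n m) where
  open CoChain C public
  open IsChainGraph isChain renaming (cover to V≡X∪Y; disjoint to X∩Y≡⊥)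

  X⊆V : X Subset.⊆ V H
  X⊆V {u} u∈X = subst (u Subset.∈_) V≡X∪Y (Subset.x∈p∪q⁺ (inj₁ u∈X))

  Y⊆V : Y Subset.⊆ V H
  Y⊆V {u} u∈Y = subst (u Subset.∈_) V≡X∪Y (Subset.x∈p∪q⁺ (inj₂ u∈Y))

  V⊆X∪Y : ∀ {u} → u Subset.∈ V H → u Subset.∈ X ⊎ u Subset.∈ Y
  V⊆X∪Y {u} u∈V = Subset.x∈p∪q⁻ X Y (subst (u Subset.∈_) (sym V≡X∪Y) u∈V)

  X∩Y : ∀ {u} → u Subset.∈ X → u Subset.∉ Y
  X∩Y {u} u∈X u∈Y = Subset.∉⊥ (subst (u Subset.∈_) X∩Y≡⊥ (Subset.x∈p∩q⁺ (u∈X , u∈Y)))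

  clique-X : IsClique G X
  clique-X = X⊆V , λ u∈X v∈X u≢v → (X⊆V u∈X , X⊆V v∈X) , u≢v , λ adj →
    [ (λ { (_ , v∈Y) → X∩Y v∈X v∈Y }) , (λ { (u∈Y , _) → X∩Y u∈X u∈Y }) ]′ (crossing adj)

  clique-Y : IsClique G Y
  clique-Y = Y⊆V , λ u∈Y v∈Y u≢v → (Y⊆V u∈Y , Y⊆V v∈Y) , u≢v , λ adj →
    [ (λ { (u∈X , _) → X∩Y u∈X u∈Y }) , (λ { (_ , v∈X) → X∩Y v∈X v∈Y }) ]′ (crossing adj)

  Gᵇ-crossing : ∀ {u v} → Adj Gᵇ u v → (u Subset.∈ X × v Subset.∈ Y) ⊎ (u Subset.∈ Y × v Subset.∈ X)
  Gᵇ-crossing ((((u∈V , v∈V) , _) , ¬X) , ¬Y) with V⊆X∪Y u∈V | V⊆X∪Y v∈V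
  ... | inj₁ u∈X | inj₁ v∈X = contradiction (u∈X , v∈X) ¬X
  ... | inj₁ u∈X | inj₂ v∈Y = inj₁ (u∈X , v∈Y)
  ... | inj₂ u∈Y | inj₁ v∈X = inj₂ (u∈Y , v∈X)
  ... | inj₂ u∈Y | inj₂ v∈Y = contradiction (u∈Y , v∈Y) ¬Y

  Gᵇ-X→Y : ∀ {u v} → Adj Gᵇ u v → u Subset.∈ X → v Subset.∈ Y
  Gᵇ-X→Y adj u∈X with Gᵇ-crossing adj
  ... | inj₁ (_ , v∈Y) = v∈Y
  ... | inj₂ (u∈Y , _) = contradiction u∈Y (X∩Y u∈X)

  Gᵇ-adj : ∀ {u v} → u Subset.∈ X → v Subset.∈ Y → ¬ Adj H u v → Adj Gᵇ u v
  Gᵇ-adj u∈X v∈Y ¬adj =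
    (((X⊆V u∈X , Y⊆V v∈Y) , (λ { refl → X∩Y u∈X v∈Y }) , ¬adj) , λ { (_ , v∈X) → X∩Y v∈X v∈Y })
    , λ { (u∈Y , _) → X∩Y u∈X u∈Y }

  -- A neighbourhood in `Gᵇ` of a vertex of X is the complement in Y of its neighbourhood in `H`, so
  -- every inclusion is reversed.
  isChain-Gᵇ : IsChainGraph Gᵇ X Y
  isChain-Gᵇ = record
    { cover    = V≡X∪Y
    ; disjoint = X∩Y≡⊥
    ; crossing = Gᵇ-crossing
    ; chain    = chainᵇ
    }
    where
    reverse : ∀ {u v} → u Subset.∈ X → v Subset.∈ X → 𝒩 H v Subset.⊆ 𝒩 H u → 𝒩 Gᵇ u Subset.⊆ 𝒩 Gᵇ v
    reverse u∈X v∈X v⊆u w∈ with ∈-𝒩⁻ Gᵇ w∈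
    ... | adj@(((_ , _ , ¬uw) , _) , _) = ∈-𝒩⁺ Gᵇ (Gᵇ-adj v∈X (Gᵇ-X→Y adj u∈X) (λ vw → ¬uw (∈-𝒩⁻ H (v⊆u (∈-𝒩⁺ H vw)))))
    chainᵇ : ∀ {u v} → u Subset.∈ X → v Subset.∈ X → 𝒩 Gᵇ u Subset.⊆ 𝒩 Gᵇ v ⊎ 𝒩 Gᵇ v Subset.⊆ 𝒩 Gᵇ u
    chainᵇ u∈X v∈X with chain u∈X v∈X
    ... | inj₁ u⊆v = inj₂ (reverse v∈X u∈X u⊆v)
    ... | inj₂ v⊆u = inj₁ (reverse u∈X v∈X v⊆u)

  xs ys : List (Fin _)
  xs = elements X
  ys = elements Y

  length-xs : length xs ≡ n
  length-xs = trans (length-elements X) ∣X∣≡n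

  length-ys : length ys ≡ m
  length-ys = trans (length-elements Y) ∣Y∣≡m

  xs∩ys : ∀ {w} → w ∈ xs → w ∉ ys
  xs∩ys w∈xs w∈ys = X∩Y (∈-elements⁻ X w∈xs) (∈-elements⁻ Y w∈ys)

  -- The ends of an edge lie on different sides, both in X or both in Y. With the crossing edges in
  -- front, their matching is chosen first and then completed.
  edges-G : edges G ↭ edges Gᵇ ++ pairs xs ++ pairs ys
  edges-G = unique∧set⇒↭ (edges-unique G)
    (Unique.++⁺ (edges-unique Gᵇ)
      (Unique.++⁺ (pairs-unique (elements-unique X)) (pairs-unique (elements-unique Y))
        (λ { (e∈ , e∈′) → xs∩ys (proj₁ (∈-pairs⁻ xs e∈)) (proj₁ (∈-pairs⁻ ys e∈′)) }))
      (λ { (e∈ , e∈′) → crossing∉ e∈ (∈-++⁻ (pairs xs) e∈′) }))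
    (mk⇔ to from)
    where
    crossing∉ : ∀ {e} → e ∈ edges Gᵇ → ¬ (e ∈ pairs xs ⊎ e ∈ pairs ys)
    crossing∉ e∈ (inj₁ e∈′) with ∈-edges⁻ Gᵇ e∈ | ∈-pairs⁻ xs e∈′
    ... | _ , ((_ , ¬X) , _) | u∈ , v∈ = ¬X (∈-elements⁻ X u∈ , ∈-elements⁻ X v∈)
    crossing∉ e∈ (inj₂ e∈′) with ∈-edges⁻ Gᵇ e∈ | ∈-pairs⁻ ys e∈′
    ... | _ , (_ , ¬Y) | u∈ , v∈ = ¬Y (∈-elements⁻ Y u∈ , ∈-elements⁻ Y v∈)
    clique-pairs : ∀ S {u v} → u Subset.∈ S → v Subset.∈ S → u Fin.< v → (u , v) ∈ pairs (elements S)
    clique-pairs S u∈ v∈ u<v = ∈-pairs⁺ Fin.<-asym (elements-sorted S) (∈-elements⁺ u∈) (∈-elements⁺ v∈) u<v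
    to : ∀ {e} → e ∈ edges G → e ∈ edges Gᵇ ++ pairs xs ++ pairs ys
    to e∈ with ∈-edges⁻ G e∈
    ... | u<v , adj@((u∈V , v∈V) , _) with V⊆X∪Y u∈V | V⊆X∪Y v∈V
    ... | inj₁ u∈X | inj₁ v∈X = ∈-++⁺ʳ (edges Gᵇ) (∈-++⁺ˡ (clique-pairs X u∈X v∈X u<v))
    ... | inj₂ u∈Y | inj₂ v∈Y = ∈-++⁺ʳ (edges Gᵇ) (∈-++⁺ʳ (pairs xs) (clique-pairs Y u∈Y v∈Y u<v))
    ... | inj₁ u∈X | inj₂ v∈Y = ∈-++⁺ˡ (∈-edges⁺ Gᵇ u<v
      ((adj , (λ { (_ , v∈X) → X∩Y v∈X v∈Y })) , λ { (u∈Y , _) → X∩Y u∈X u∈Y }))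
    ... | inj₂ u∈Y | inj₁ v∈X = ∈-++⁺ˡ (∈-edges⁺ Gᵇ u<v
      ((adj , (λ { (u∈X , _) → X∩Y u∈X u∈Y })) , λ { (_ , v∈Y) → X∩Y v∈X v∈Y }))
    from : ∀ {e} → e ∈ edges Gᵇ ++ pairs xs ++ pairs ys → e ∈ edges G
    from e∈ with ∈-++⁻ (edges Gᵇ) e∈
    ... | inj₁ e∈ = let u<v , (adj , _) , _ = ∈-edges⁻ Gᵇ e∈ in ∈-edges⁺ G u<v adj
    ... | inj₂ e∈ with ∈-++⁻ (pairs xs) e∈
    ...   | inj₁ e∈ = let u<v = ∈-pairs⁻-< (elements-sorted X) e∈ ; u∈ , v∈ = ∈-pairs⁻ xs e∈ in
      ∈-edges⁺ G u<v (proj₂ clique-X (∈-elements⁻ X u∈) (∈-elements⁻ X v∈) (Fin.<⇒≢ u<v))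
    ...   | inj₂ e∈ = let u<v = ∈-pairs⁻-< (elements-sorted Y) e∈ ; u∈ , v∈ = ∈-pairs⁻ ys e∈ in
      ∈-edges⁺ G u<v (proj₂ clique-Y (∈-elements⁻ Y u∈) (∈-elements⁻ Y v∈) (Fin.<⇒≢ u<v))

  crosses-X : ∀ {e} → e ∈ edges Gᵇ → Crosses xs e
  crosses-X e∈ with Gᵇ-crossing (proj₂ (∈-edges⁻ Gᵇ e∈))
  ... | inj₁ (u∈X , v∈Y) = inj₁ (∈-elements⁺ u∈X , λ v∈ → X∩Y (∈-elements⁻ X v∈) v∈Y)
  ... | inj₂ (u∈Y , v∈X) = inj₂ (∈-elements⁺ v∈X , λ u∈ → X∩Y (∈-elements⁻ X u∈) u∈Y)

  crosses-Y : ∀ {e} → e ∈ edges Gᵇ → Crosses ys e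
  crosses-Y e∈ with Gᵇ-crossing (proj₂ (∈-edges⁻ Gᵇ e∈))
  ... | inj₁ (u∈X , v∈Y) = inj₂ (∈-elements⁺ v∈Y , λ u∈ → X∩Y u∈X (∈-elements⁻ Y u∈))
  ... | inj₂ (u∈Y , v∈X) = inj₁ (∈-elements⁺ u∈Y , λ v∈ → X∩Y v∈X (∈-elements⁻ Y v∈))

  p-G : ∀ {k} → n ⊓ m ≤ k →
        p G ≡ ∑ (upTo (suc k)) (λ s → numMatchings Gᵇ s * p (K (n ∸ s)) * p (K (m ∸ s)))
  p-G {k} n⊓m≤k = begin
    p G
      ≡⟨ p-perfect G (xs ++ ys) edges-G (mk⇔
           (λ w∈V → [ ∈-++⁺ˡ ∘ ∈-elements⁺ , ∈-++⁺ʳ xs ∘ ∈-elements⁺ ]′ (V⊆X∪Y w∈V))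
           (λ w∈ → [ X⊆V ∘ ∈-elements⁻ X , Y⊆V ∘ ∈-elements⁻ Y ]′ (∈-++⁻ xs w∈))) ⟩
    ∑ (subsets (edges Gᵇ ++ pairs xs ++ pairs ys)) (λ b → ⟦ perfect? (xs ++ ys) b ⟧)
      ≡⟨ perfects-cliques (elements-unique X) (elements-unique Y) xs∩ys crosses-X crosses-Y
           (subst (_≤ k) (sym (cong₂ _⊓_ length-xs length-ys)) n⊓m≤k) ⟩
    ∑ (upTo (suc k)) (λ s → matchings s (edges Gᵇ) * numPerfect (length xs ∸ s) * numPerfect (length ys ∸ s))
      ≡⟨ ∑-cong (upTo (suc k)) (λ {s} _ → cong₂ _*_ (cong₂ _*_
           (sym (numMatchings-matchings Gᵇ s))
           (trans (cong (λ l → numPerfect (l ∸ s)) length-xs) (sym (p-K (n ∸ s)))))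
           (trans (cong (λ l → numPerfect (l ∸ s)) length-ys) (sym (p-K (m ∸ s))))) ⟩
    ∑ (upTo (suc k)) (λ s → numMatchings Gᵇ s * p (K (n ∸ s)) * p (K (m ∸ s))) ∎
    where open ≡-Reasoning

-- Adding the vertices of X one by one

open import Data.Integer.Base using (+_; 1ℤ) renaming (_+_ to _+ℤ_; _-_ to _-ℤ_; _*_ to _*ℤ_)

-- `edges` puts the smaller vertex first, whereas a neighbour of `x i` may be smaller or larger than
-- `x i` as an element of `Fin N`.
sortEdge : Fin N → Fin N → Edge N
sortEdge w u with w Fin.<? u
... | yes _ = w , u
... | no  _ = u , w

incident-sortEdge : ∀ {w u x : Fin N} → Incident x (sortEdge w u) ⇔ (x ≡ w ⊎ x ≡ u)
incident-sortEdge {w = w} {u} with w Fin.<? u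
... | yes _ = mk⇔ id id
... | no  _ = mk⇔ swap swap

sortEdge-injective : ∀ {w u v : Fin N} → sortEdge w u ≡ sortEdge w v → u ≡ v
sortEdge-injective {w = w} {u} {v} eq with w Fin.<? u | w Fin.<? v
sortEdge-injective refl | yes _ | yes _ = refl
sortEdge-injective refl | yes _ | no  _ = refl
sortEdge-injective refl | no  _ | yes _ = refl
sortEdge-injective refl | no  _ | no  _ = refl

sortEdge-< : ∀ {w u : Fin N} → w Fin.< u → sortEdge w u ≡ (w , u)
sortEdge-< {w = w} {u} w<u with w Fin.<? u
... | yes _   = refl
... | no  w≮u = contradiction w<u w≮u

sortEdge-> : ∀ {w u : Fin N} → u Fin.< w → sortEdge w u ≡ (u , w)
sortEdge-> {w = w} {u} u<w with w Fin.<? u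
... | yes w<u = contradiction w<u (Fin.<-asym u<w)
... | no  _   = refl

∈-take-tabulate⁺ : ∀ {n} i (f : Fin n → A) j → toℕ j < i → f j ∈ take i (tabulate f)
∈-take-tabulate⁺ (suc i) f zero    _         = here refl
∈-take-tabulate⁺ (suc i) f (suc j) (s≤s j<i) = there (∈-take-tabulate⁺ i (f ∘ suc) j j<i)

∈-take-tabulate⁻ : ∀ {n} i (f : Fin n → A) {z} → z ∈ take i (tabulate f) → ∃ λ j → toℕ j < i × f j ≡ z
∈-take-tabulate⁻ {n = suc n} (suc i) f (here refl) = zero , s≤s z≤n , refl
∈-take-tabulate⁻ {n = suc n} (suc i) f (there z∈) with ∈-take-tabulate⁻ i (f ∘ suc) z∈
... | j , j<i , eq = suc j , s≤s j<i , eq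

∈-⋃⁺ : ∀ {S} {Ss : List (Subset N)} {u} → S ∈ Ss → u Subset.∈ S → u Subset.∈ ⋃ Ss
∈-⋃⁺ {Ss = S ∷ Ss} (here refl) u∈S = Subset.x∈p∪q⁺ (inj₁ u∈S)
∈-⋃⁺ {Ss = S ∷ Ss} (there S∈)  u∈S = Subset.x∈p∪q⁺ {p = S} (inj₂ (∈-⋃⁺ S∈ u∈S))

∈-⋃⁻ : ∀ (Ss : List (Subset N)) {u} → u Subset.∈ ⋃ Ss → ∃ λ S → S ∈ Ss × u Subset.∈ S
∈-⋃⁻ []       u∈ = contradiction u∈ Subset.∉⊥
∈-⋃⁻ (S ∷ Ss) u∈ with Subset.x∈p∪q⁻ S (⋃ Ss) u∈
... | inj₁ u∈S = S , here refl , u∈S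
... | inj₂ u∈⋃ = let T , T∈ , u∈T = ∈-⋃⁻ Ss u∈⋃ in T , there T∈ , u∈T

module _ {n} (x : Fin n → Fin N) where

  ∈-initial⁺ : ∀ {i} j → toℕ j < i → x j Subset.∈ initial x i
  ∈-initial⁺ {i} j j<i = ∈-⋃⁺ (∈-map⁺ (⁅_⁆ ∘ x) (∈-take-tabulate⁺ i id j j<i)) (Subset.x∈⁅x⁆ (x j))

  ∈-initial⁻ : ∀ i {u} → u Subset.∈ initial x i → ∃ λ j → toℕ j < i × x j ≡ u
  ∈-initial⁻ i u∈ with ∈-⋃⁻ (map (⁅_⁆ ∘ x) (take i (allFin n))) u∈
  ... | _ , S∈ , u∈S with ∈-map⁻ (⁅_⁆ ∘ x) S∈
  ...   | k , k∈ , refl with ∈-take-tabulate⁻ i id k∈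
  ...     | j , j<i , refl = j , j<i , sym (Subset.x∈⁅y⁆⇒x≡y (x j) u∈S)

-- With truncated subtraction this is the recurrence of the theorem, since
-- M(i , s) = 0 when s exceeds deg(xᵢ₊₁).
table : (ℕ → ℕ) → ℕ → ℕ → ℕ
table d i       zero    = 1
table d zero    (suc s) = 0
table d (suc i) (suc s) = table d i (suc s) + (d i ∸ s) * table d i s

table-< : ∀ d {i s} → i < s → table d i s ≡ 0
table-< d {zero}  {suc s} _         = refl
table-< d {suc i} {suc s} (s≤s i<s) = cong₂ _+_ (table-< d (ℕ.m≤n⇒m≤1+n i<s))
  (trans (cong ((d i ∸ s) *_) (table-< d i<s)) (ℕ.*-zeroʳ (d i ∸ s)))

extend-< : ∀ {k} (f : Fin k → ℕ) {i} (i<k : i < k) → extend f i ≡ f (fromℕ< i<k)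
extend-< {k} f {i} i<k with i ℕ.<? k
... | yes i<k′ = cong f (Fin.fromℕ<-cong i i refl i<k′ i<k)
... | no  i≮k  = contradiction i<k i≮k

module OrderingProperties {n m} (C : CoChain n m) (o : CoChain.Ordering C) where
  open CoChainProperties C
  open IsChainOrdering (proj₂ o)

  x : Fin n → Fin _
  x = proj₁ o

  layer : ℕ → Subset _
  layer i = initial x i ∪ Y

  E : ℕ → List (Edge _)
  E i = edges (induce Gᵇ (layer i))

  neighbours : Fin n → List (Fin _)
  neighbours i = elements (𝒩 Gᵇ (x i))

  layer-X : ∀ i {u} → u Subset.∈ X → u Subset.∈ layer i → ∃ λ j → toℕ j < i × x j ≡ u
  layer-X i u∈X u∈ with Subset.x∈p∪q⁻ (initial x i) Y u∈
  ... | inj₁ u∈init = ∈-initial⁻ x i u∈init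
  ... | inj₂ u∈Y    = contradiction u∈Y (X∩Y u∈X)

  layer-suc : ∀ (i : Fin n) {u} → u Subset.∈ layer (toℕ i) → u Subset.∈ layer (suc (toℕ i))
  layer-suc i u∈ with Subset.x∈p∪q⁻ (initial x (toℕ i)) Y u∈
  ... | inj₂ u∈Y = Subset.x∈p∪q⁺ (inj₂ u∈Y)
  ... | inj₁ u∈init with ∈-initial⁻ x (toℕ i) u∈init
  ...   | j , j<i , refl = Subset.x∈p∪q⁺ (inj₁ (∈-initial⁺ x j (ℕ.m≤n⇒m≤1+n j<i)))

  layer-pred : ∀ i {u} → u ≢ x i → u Subset.∈ layer (suc (toℕ i)) → u Subset.∈ layer (toℕ i)
  layer-pred i u≢xᵢ u∈ with Subset.x∈p∪q⁻ (initial x (suc (toℕ i))) Y u∈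
  ... | inj₂ u∈Y = Subset.x∈p∪q⁺ (inj₂ u∈Y)
  ... | inj₁ u∈init with ∈-initial⁻ x (suc (toℕ i)) u∈init
  ...   | j , s≤s j≤i , refl = Subset.x∈p∪q⁺ (inj₁ (∈-initial⁺ x j
            (ℕ.≤∧≢⇒< j≤i (λ j≡i → u≢xᵢ (cong x (Fin.toℕ-injective j≡i))))))

  x∉layer : ∀ i → x i Subset.∉ layer (toℕ i)
  x∉layer i xᵢ∈ with layer-X (toℕ i) (into i) xᵢ∈
  ... | j , j<i , xⱼ≡xᵢ = ℕ.<⇒≢ j<i (cong toℕ (injective xⱼ≡xᵢ))

  neighbours⁻ : ∀ i {u} → u ∈ neighbours i → Adj Gᵇ (x i) u
  neighbours⁻ i u∈ = ∈-𝒩⁻ Gᵇ (∈-elements⁻ (𝒩 Gᵇ (x i)) u∈)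

  neighbours⊆Y : ∀ i {u} → u ∈ neighbours i → u Subset.∈ Y
  neighbours⊆Y i u∈ = Gᵇ-X→Y (neighbours⁻ i u∈) (into i)

  not-through : ∀ i {e} → e ∈ E (toℕ i) → ¬ Incident (x i) e
  not-through i e∈ inc with ∈-edges⁻ (induce Gᵇ (layer (toℕ i))) e∈ | inc
  ... | _ , (u∈ , v∈) , _ | inj₁ refl = x∉layer i u∈
  ... | _ , (u∈ , v∈) , _ | inj₂ refl = x∉layer i v∈

  -- Here the ordering by inclusion enters: a vertex of X already present comes before `x i`, so its
  -- neighbours are neighbours of `x i`. Every edge present therefore has its Y-end among
  -- `neighbours i`.
  nested-neighbours : ∀ i {u v} → u Subset.∈ X → u Subset.∈ layer (toℕ i) → Adj Gᵇ u v → v ∈ neighbours i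
  nested-neighbours i u∈X u∈ adj with layer-X (toℕ i) u∈X u∈
  ... | j , j<i , refl = ∈-elements⁺ (nested (ℕ.<⇒≤ j<i) (∈-𝒩⁺ Gᵇ adj))

  crosses-neighbours : ∀ i {e} → e ∈ E (toℕ i) → Crosses (neighbours i) e
  crosses-neighbours i e∈ with ∈-edges⁻ (induce Gᵇ (layer (toℕ i))) e∈
  ... | _ , (u∈ , v∈) , adj with Gᵇ-crossing adj
  ...   | inj₁ (u∈X , v∈Y) = inj₂ (nested-neighbours i u∈X u∈ adj , λ u∈N → X∩Y u∈X (neighbours⊆Y i u∈N))
  ...   | inj₂ (u∈Y , v∈X) = inj₁ (nested-neighbours i v∈X v∈ (symm Gᵇ adj) , λ v∈N → X∩Y v∈X (neighbours⊆Y i v∈N))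

  module S i = Star {w = x i} {neighbours i} {E (toℕ i)} (sortEdge (x i)) incident-sortEdge
    (elements-unique (𝒩 Gᵇ (x i))) (not-through i) (crosses-neighbours i)

  -- `x` is indexed from 0, so `x i` is the vertex added in passing from `layer (toℕ i)` to the next
  -- layer. All its neighbours lie in Y and are present, so its new edges number its full degree.
  E-suc : ∀ i → E (suc (toℕ i)) ↭ map (sortEdge (x i)) (neighbours i) ++ E (toℕ i)
  E-suc i = unique∧set⇒↭ (edges-unique (induce Gᵇ (layer (suc (toℕ i)))))
    (Unique.++⁺ (Unique.map⁺ sortEdge-injective (elements-unique (𝒩 Gᵇ (x i)))) (edges-unique (induce Gᵇ (layer (toℕ i)))) disj)
    (mk⇔ to from)
    where
    G⁺ = induce Gᵇ (layer (suc (toℕ i)))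
    G⁻ = induce Gᵇ (layer (toℕ i))
    disj : ∀ {e} → ¬ (e ∈ map (sortEdge (x i)) (neighbours i) × e ∈ E (toℕ i))
    disj (e∈ , e∈′) with ∈-map⁻ (sortEdge (x i)) e∈
    ... | u , _ , refl = not-through i e∈′ (Equivalence.from (incident-sortEdge {w = x i} {u}) (inj₁ refl))
    to : ∀ {e} → e ∈ E (suc (toℕ i)) → e ∈ map (sortEdge (x i)) (neighbours i) ++ E (toℕ i)
    to {u , v} e∈ with ∈-edges⁻ G⁺ e∈ | u Fin.≟ x i | v Fin.≟ x i
    ... | u<v , _ , adj | yes refl | _ = ∈-++⁺ˡ (subst (_∈ _) (sortEdge-< u<v)
      (∈-map⁺ (sortEdge (x i)) (∈-elements⁺ (∈-𝒩⁺ Gᵇ adj))))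
    ... | u<v , _ , adj | no _ | yes refl = ∈-++⁺ˡ (subst (_∈ _) (sortEdge-> u<v)
      (∈-map⁺ (sortEdge (x i)) (∈-elements⁺ (∈-𝒩⁺ Gᵇ (symm Gᵇ adj)))))
    ... | u<v , (u∈ , v∈) , adj | no u≢ | no v≢ =
      ∈-++⁺ʳ (map (sortEdge (x i)) (neighbours i)) (∈-edges⁺ G⁻ u<v ((layer-pred i u≢ u∈ , layer-pred i v≢ v∈) , adj))
    xᵢ∈ : x i Subset.∈ layer (suc (toℕ i))
    xᵢ∈ = Subset.x∈p∪q⁺ (inj₁ (∈-initial⁺ x i ℕ.≤-refl))
    from : ∀ {e} → e ∈ map (sortEdge (x i)) (neighbours i) ++ E (toℕ i) → e ∈ E (suc (toℕ i))
    from e∈ with ∈-++⁻ (map (sortEdge (x i)) (neighbours i)) e∈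
    from {u , v} _ | inj₂ e∈ = let u<v , (u∈ , v∈) , adj = ∈-edges⁻ G⁻ e∈ in
      ∈-edges⁺ G⁺ u<v ((layer-suc i u∈ , layer-suc i v∈) , adj)
    from _ | inj₁ e∈ with ∈-map⁻ (sortEdge (x i)) e∈
    ... | u , u∈ , refl with Fin.<-cmp (x i) u
    ...   | tri< w<u _ _ = subst (_∈ E (suc (toℕ i))) (sym (sortEdge-< w<u))
      (∈-edges⁺ G⁺ w<u ((xᵢ∈ , Subset.x∈p∪q⁺ (inj₂ (neighbours⊆Y i u∈))) , neighbours⁻ i u∈))
    ...   | tri> _ _ u<w = subst (_∈ E (suc (toℕ i))) (sym (sortEdge-> u<w))
      (∈-edges⁺ G⁺ u<w ((Subset.x∈p∪q⁺ (inj₂ (neighbours⊆Y i u∈)) , xᵢ∈) , symm Gᵇ (neighbours⁻ i u∈)))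
    ...   | tri≈ _ w≡u _ = contradiction (neighbours⁻ i u∈) (irrefl Gᵇ w≡u)

  length-neighbours : ∀ i → length (neighbours i) ≡ degree o i
  length-neighbours i = length-elements (𝒩 Gᵇ (x i))

  M-matchings : ∀ i s → M o i s ≡ matchings s (E i)
  M-matchings i s = numMatchings-matchings (induce Gᵇ (layer i)) s

  M-suc : ∀ i s → M o (suc (toℕ i)) (suc s) ≡ M o (toℕ i) (suc s) + (degree o i ∸ s) * M o (toℕ i) s
  M-suc i s = begin
    M o (suc (toℕ i)) (suc s)
      ≡⟨ M-matchings (suc (toℕ i)) (suc s) ⟩
    matchings (suc s) (E (suc (toℕ i)))
      ≡⟨ matchings-↭ (suc s) (E-suc i) ⟩
    matchings (suc s) (map (sortEdge (x i)) (neighbours i) ++ E (toℕ i))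
      ≡⟨ S.matchings-star i s ⟩
    matchings (suc s) (E (toℕ i)) + (length (neighbours i) ∸ s) * matchings s (E (toℕ i))
      ≡⟨ cong₂ _+_ (sym (M-matchings (toℕ i) (suc s)))
           (cong₂ _*_ (cong (_∸ s) (length-neighbours i)) (sym (M-matchings (toℕ i) s))) ⟩
    M o (toℕ i) (suc s) + (degree o i ∸ s) * M o (toℕ i) s ∎
    where open ≡-Reasoning

  M-large : ∀ i {s} → degree o i < s → M o (toℕ i) s ≡ 0
  M-large i {s} d<s = trans (M-matchings (toℕ i) s)
    (S.matchings-large i (subst (_< s) (sym (length-neighbours i)) d<s))

  M-0 : ∀ i → M o i 0 ≡ 1
  M-0 i = trans (M-matchings i 0) (matchings-0 (E i))

  M-all : ∀ s → M o n s ≡ numMatchings Gᵇ s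
  M-all s = begin
    M o n s                 ≡⟨ M-matchings n s ⟩
    matchings s (E n)       ≡⟨ matchings-↭ s (unique∧set⇒↭ (edges-unique (induce Gᵇ (layer n))) (edges-unique Gᵇ) (mk⇔
      (λ e∈ → let u<v , _ , adj = ∈-edges⁻ (induce Gᵇ (layer n)) e∈ in ∈-edges⁺ Gᵇ u<v adj)
      (λ e∈ → let u<v , adj = ∈-edges⁻ Gᵇ e∈ in
        ∈-edges⁺ (induce Gᵇ (layer n)) u<v ((all∈ (adj-∈ Gᵇ adj) , all∈ (adj-∈ Gᵇ (symm Gᵇ adj))) , adj)))) ⟩
    matchings s (edges Gᵇ)  ≡⟨ numMatchings-matchings Gᵇ s ⟨
    numMatchings Gᵇ s       ∎
    where
    open ≡-Reasoning
    all∈ : ∀ {u} → u Subset.∈ V Gᵇ → u Subset.∈ layer n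
    all∈ u∈V with V⊆X∪Y u∈V
    ... | inj₂ u∈Y = Subset.x∈p∪q⁺ (inj₂ u∈Y)
    ... | inj₁ u∈X with onto u∈X
    ...   | j , refl = Subset.x∈p∪q⁺ (inj₁ (∈-initial⁺ x j (Fin.toℕ<n j)))

  M-table : ∀ i s → i ≤ n → M o i s ≡ table (extend (degree o)) i s
  M-table i       zero    i≤n = M-0 i
  -- `layer 0` contains no vertex of X, and every edge of `Gᵇ` needs one.
  M-table zero    (suc s) i≤n = trans (M-matchings 0 (suc s)) (cong (matchings (suc s)) (empty (E 0) no-edge))
    where
    no-edge : ∀ {e} → e ∉ E 0
    no-edge e∈ with ∈-edges⁻ (induce Gᵇ (layer 0)) e∈
    ... | _ , (u∈ , v∈) , adj with Gᵇ-crossing adj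
    ...   | inj₁ (u∈X , _) = contradiction (proj₁ (proj₂ (layer-X 0 u∈X u∈))) λ ()
    ...   | inj₂ (_ , v∈X) = contradiction (proj₁ (proj₂ (layer-X 0 v∈X v∈))) λ ()
    empty : ∀ (es : List (Edge _)) → (∀ {e} → e ∉ es) → es ≡ []
    empty []       _ = refl
    empty (e ∷ es) ∉ = contradiction (here refl) ∉
  M-table (suc i) (suc s) i<n = begin
    M o (suc i) (suc s)
      ≡⟨ cong (λ i → M o (suc i) (suc s)) (Fin.toℕ-fromℕ< i<n) ⟨
    M o (suc (toℕ j)) (suc s)
      ≡⟨ M-suc j s ⟩
    M o (toℕ j) (suc s) + (degree o j ∸ s) * M o (toℕ j) s
      ≡⟨ cong₂ (λ i d → M o i (suc s) + (d ∸ s) * M o i s) (Fin.toℕ-fromℕ< i<n) (sym (extend-< (degree o) i<n)) ⟩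
    M o i (suc s) + (extend (degree o) i ∸ s) * M o i s
      ≡⟨ cong₂ (λ a b → a + (extend (degree o) i ∸ s) * b) (M-table i (suc s) (ℕ.<⇒≤ i<n)) (M-table i s (ℕ.<⇒≤ i<n)) ⟩
    table (extend (degree o)) (suc i) (suc s) ∎
    where
    open ≡-Reasoning
    j = fromℕ< i<n

  -- If `s` is at most the degree, subtraction in ℕ and in ℤ agree; if it exceeds the degree,
  -- `M-large` makes the other factor 0.
  M-recurrence : ∀ i s → + M o (suc (toℕ i)) (suc s)
    ≡ + M o (toℕ i) (suc s) +ℤ ((+ degree o i) -ℤ (+ suc s) +ℤ 1ℤ) *ℤ (+ M o (toℕ i) s)
  M-recurrence i s = begin
    + M o (suc (toℕ i)) (suc s)
      ≡⟨ cong +_ (M-suc i s) ⟩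
    + (M o (toℕ i) (suc s) + (degree o i ∸ s) * M o (toℕ i) s)
      ≡⟨ cong (+ M o (toℕ i) (suc s) +ℤ_) (trans (ℤ.pos-* (degree o i ∸ s) (M o (toℕ i) s)) (coefficient (s ℕ.≤? degree o i))) ⟩
    + M o (toℕ i) (suc s) +ℤ ((+ degree o i) -ℤ (+ suc s) +ℤ 1ℤ) *ℤ (+ M o (toℕ i) s) ∎
    where
    open ≡-Reasoning
    shift : ∀ d s → + d -ℤ + suc s +ℤ 1ℤ ≡ + d -ℤ + s
    shift d s = ℤ-shift (+ d) (+ s)
      where
      ℤ-shift : ∀ d s → d -ℤ (1ℤ +ℤ s) +ℤ 1ℤ ≡ d -ℤ s
      ℤ-shift = ℤSolver.solve-∀
    coefficient : Dec (s ≤ degree o i) →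
      + (degree o i ∸ s) *ℤ + M o (toℕ i) s ≡ ((+ degree o i) -ℤ (+ suc s) +ℤ 1ℤ) *ℤ + M o (toℕ i) s
    coefficient (yes s≤d) = cong (_*ℤ + M o (toℕ i) s)
      (sym (trans (shift (degree o i) s) (trans (ℤ.m-n≡m⊖n (degree o i) s) (ℤ.⊖-≥ s≤d))))
    coefficient (no s≰d) rewrite M-large i (ℕ.≰⇒> s≰d) =
      trans (ℤ.*-zeroʳ (+ (degree o i ∸ s))) (sym (ℤ.*-zeroʳ ((+ degree o i) -ℤ (+ suc s) +ℤ 1ℤ)))

-- Programs

update-same : ∀ (f : ℕ → ℕ) {i j} a → i ≡ j → (f [ i ↦ a ]) j ≡ a
update-same f {i} a refl with i ≡ᵇ i | ℕ.≡⇒≡ᵇ i i refl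
... | true | _ = refl

update-other : ∀ (f : ℕ → ℕ) {i j} a → i ≢ j → (f [ i ↦ a ]) j ≡ f j
update-other f {i} {j} a i≢j with i ≡ᵇ j | ℕ.≡ᵇ⇒≡ i j
... | true  | i≡j = contradiction (i≡j _) i≢j
... | false | _   = refl

-- `I k` speaks of the state after `k` passes, before the counter is set to `k`; `I b` is what the
-- whole loop achieves.
module _ r (P : Program) (I : ℕ → State → Set) {b}
         (step : ∀ {k σ} → k < b → I k σ → I (suc k) (exec P (setReg r k σ))) where

  loop-invariant : ∀ {σ} k → k ≤ b → I 0 σ → I k (loop r P k σ)
  loop-invariant zero    k≤b I₀ = I₀
  loop-invariant (suc k) k<b I₀ = step k<b (loop-invariant k (ℕ.<⇒≤ k<b) I₀)

  for-invariant : ∀ {e σ} → eval e σ ≡ b → I 0 σ → I b (exec (for r < e ⟨ P ⟩) σ)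
  for-invariant refl = loop-invariant b ℕ.≤-refl

  module _ {c} (time≤c : ∀ {k σ} → k < b → I k σ → time P (setReg r k σ) ≤ c) where

    loopTime-≤ : ∀ {σ} k → k ≤ b → I 0 σ → loopTime r P k σ ≤ k * suc c
    loopTime-≤ zero    k≤b I₀ = z≤n
    loopTime-≤ (suc k) k<b I₀ = ℕ.≤-trans
      (ℕ.+-mono-≤ (loopTime-≤ k (ℕ.<⇒≤ k<b) I₀) (s≤s (time≤c k<b (loop-invariant k (ℕ.<⇒≤ k<b) I₀))))
      (ℕ.≤-reflexive (ℕ.+-comm (k * suc c) (suc c)))

    for-time : ∀ {e σ} → eval e σ ≡ b → I 0 σ → time (for r < e ⟨ P ⟩) σ ≤ suc (cost e + b * suc c)
    for-time {e} refl I₀ = s≤s (ℕ.+-monoʳ-≤ (cost e) (loopTime-≤ b ℕ.≤-refl I₀))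

-- Row-major address with rows of length n + 1. The literal stands on the left so that the row
-- length evaluates definitionally to a successor.
entryAt : Expr → Expr → Expr
entryAt i s = (i ⊗ (lit 1 ⊕ reg 0)) ⊕ s

-- Register 3 counts the rows of the table and the terms of the sum, register 4 the columns.
fillEntry fillRow fillTable : Program
fillEntry = 2 [ entryAt (lit 1 ⊕ reg 3) (lit 1 ⊕ reg 4) ]≔
  ((2 [ entryAt (reg 3) (lit 1 ⊕ reg 4) ]) ⊕ (((0 [ reg 3 ]) ⊖ reg 4) ⊗ (2 [ entryAt (reg 3) (reg 4) ])))
fillRow = (2 [ entryAt (lit 1 ⊕ reg 3) (lit 0) ]≔ lit 1) ⨟ for 4 < reg 0 ⟨ fillEntry ⟩
fillTable = (2 [ lit 0 ]≔ lit 1) ⨟ for 3 < reg 0 ⟨ fillRow ⟩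

-- The sum runs to n instead of min(n , m). For s > m the lookup at m ∸ s = 0 reads p(K₀), but M(n ,
-- s) is 0 there.
addTerm sumTerms : Program
addTerm = 2 ≔ (reg 2 ⊕ (((2 [ entryAt (reg 0) (reg 3) ]) ⊗ (1 [ reg 0 ⊖ reg 3 ])) ⊗ (1 [ reg 1 ⊖ reg 3 ])))
sumTerms = (2 ≔ lit 0) ⨟ for 3 < lit 1 ⊕ reg 0 ⟨ addTerm ⟩

-- The recurrence of `numPerfect`, started from entry 0 and from the initial 0 in entry 1. After n +
-- m passes the entries up to n + m + 1 are right, which covers all lookups at n ∸ s and m ∸ s.
nextPerfect fillPerfect : Program
nextPerfect = 1 [ lit 2 ⊕ reg 3 ]≔ ((lit 1 ⊕ reg 3) ⊗ (1 [ reg 3 ]))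
fillPerfect = (1 [ lit 0 ]≔ lit 1) ⨟ for 3 < reg 0 ⊕ reg 1 ⟨ nextPerfect ⟩

sumTable fromScratch : Program
sumTable    = fillTable ⨟ sumTerms
fromScratch = fillPerfect ⨟ sumTable

-- The zero state has n = m = 0, so that only the loop of sumTerms is entered, once.
overhead : Program → ℕ
overhead P = time P ⟪ (λ _ → 0) , (λ _ _ → 0) ⟫

-- Sums of the coefficients to which `quadratic` and `linear` are applied. The `0` is the absent
-- quadratic term of `sumTerms`.
fillTable-factor sumTable-factor fromScratch-factor : ℕ
fillTable-factor   = overhead fillTable + suc (overhead fillRow) + suc (overhead fillEntry)
sumTable-factor    = fillTable-factor + (overhead sumTerms + suc (overhead addTerm) + 0)
fromScratch-factor = (overhead fillPerfect + suc (overhead nextPerfect)) + sumTable-factor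

-- Correctness and running time of the programs

module Execution (n m : ℕ) (d κ : ℕ → ℕ) where

  -- `κ` is whatever array 1 holds: zeros, the given values p(K_t), or those computed by
  -- `fillPerfect`. One analysis serves all three.
  record Inputs (σ : State) : Set where
    constructor inputs
    field
      reg-0 : register σ 0 ≡ n
      reg-1 : register σ 1 ≡ m
      arr-0 : array σ 0 ≡ d
      arr-1 : array σ 1 ≡ κ
  open Inputs

  entry : State → ℕ → ℕ → ℕ
  entry σ i s = array σ 2 (i * suc n + s)

  -- (i , j) is the next position in row-major order.
  Filled : ℕ → ℕ → State → Set
  Filled i j σ = ∀ {i′ s} → s ≤ n → i′ < i ⊎ (i′ ≡ i × s < j) → entry σ i′ s ≡ table d i′ s

  -- Columns stay below the row length, so addresses increase along the order of filling and no
  -- write destroys an earlier entry.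
  address-< : ∀ {i j i′ s} → s ≤ n → i′ < i ⊎ (i′ ≡ i × s < j) → i′ * suc n + s < i * suc n + j
  address-< {i} {j} {i′} {s} s≤n (inj₁ i′<i) = begin-strict
    i′ * suc n + s      <⟨ ℕ.+-monoʳ-< (i′ * suc n) (s≤s s≤n) ⟩
    i′ * suc n + suc n  ≡⟨ ℕ.+-comm (i′ * suc n) (suc n) ⟩
    suc i′ * suc n      ≤⟨ ℕ.*-monoˡ-≤ (suc n) i′<i ⟩
    i * suc n           ≤⟨ ℕ.m≤m+n (i * suc n) j ⟩
    i * suc n + j       ∎
    where open ℕ.≤-Reasoning
  address-< {i} s≤n (inj₂ (refl , s<j)) = ℕ.+-monoʳ-< (i * suc n) s<j

  write : ∀ {i j a v σ} → Filled i j σ → a ≡ i * suc n + j → v ≡ table d i j → Filled i (suc j) (setArr 2 a v σ)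
  write {i} {j} {v = v} {σ} filled refl v≡ {i′} {s} s≤n before with split before
    where
    split : i′ < i ⊎ (i′ ≡ i × s < suc j) → (i′ < i ⊎ (i′ ≡ i × s < j)) ⊎ (i′ ≡ i × s ≡ j)
    split (inj₁ i′<i) = inj₁ (inj₁ i′<i)
    split (inj₂ (i′≡i , s≤s s≤j)) with ℕ.m≤n⇒m<n∨m≡n s≤j
    ... | inj₁ s<j = inj₁ (inj₂ (i′≡i , s<j))
    ... | inj₂ s≡j = inj₂ (i′≡i , s≡j)
  ... | inj₁ before′ = trans (update-other (array σ 2) v (ℕ.>⇒≢ (address-< s≤n before′))) (filled s≤n before′)
  ... | inj₂ (refl , refl) = trans (update-same (array σ 2) v refl) v≡

  next-row : ∀ {i σ} → Filled i (suc n) σ → Filled (suc i) 0 σ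
  next-row filled s≤n (inj₁ (s≤s i′≤i)) with ℕ.m≤n⇒m<n∨m≡n i′≤i
  ... | inj₁ i′<i = filled s≤n (inj₁ i′<i)
  ... | inj₂ i′≡i = filled s≤n (inj₂ (i′≡i , s≤s s≤n))

  InRow : ℕ → ℕ → State → Set
  InRow i s σ = Inputs σ × register σ 3 ≡ i × Filled (suc i) (suc s) σ

  fillEntry-correct : ∀ {i s σ} → s < n → InRow i s σ → InRow i (suc s) (exec fillEntry (setReg 4 s σ))
  fillEntry-correct {i} {s} {σ} s<n (inputs r₀ r₁ a₀ a₁ , r₃ , filled) =
    inputs r₀ r₁ a₀ a₁ , r₃ , write {σ = setReg 4 s σ} filled
      (cong₂ (λ i n → suc i * suc n + suc s) r₃ r₀) (value r₃ r₀ a₀)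
    where
    -- The register and array contents are generalised to variables so that their equations can be
    -- matched with `refl`.
    value : ∀ {i′ n′ d′} → i′ ≡ i → n′ ≡ n → d′ ≡ d →
      array σ 2 (i′ * suc n′ + suc s) + (d′ i′ ∸ s) * array σ 2 (i′ * suc n′ + s) ≡ table d (suc i) (suc s)
    value refl refl refl = cong₂ (λ a b → a + (d i ∸ s) * b)
      (filled s<n (inj₁ ℕ.≤-refl)) (filled (ℕ.<⇒≤ s<n) (inj₁ ℕ.≤-refl))

  Rows : ℕ → State → Set
  Rows i σ = Inputs σ × Filled (suc i) 0 σ

  row-start : ∀ {i σ} → Rows i σ →
    InRow i 0 (exec (2 [ entryAt (lit 1 ⊕ reg 3) (lit 0) ]≔ lit 1) (setReg 3 i σ))
  row-start {i} {σ} (inputs r₀ r₁ a₀ a₁ , filled) =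
    inputs r₀ r₁ a₀ a₁ , refl , write {σ = setReg 3 i σ} filled (cong (λ n → suc i * suc n + 0) r₀) refl

  fillRow-correct : ∀ {i σ} → i < n → Rows i σ → Rows (suc i) (exec fillRow (setReg 3 i σ))
  fillRow-correct {i} {σ} _ rows =
    let ins , _ , filled = for-invariant 4 fillEntry (InRow i) fillEntry-correct {e = reg 0} (reg-0 (proj₁ (row-start rows))) (row-start rows)
    in ins , next-row {σ = exec fillRow (setReg 3 i σ)} filled

  fillRow-time : ∀ {i σ} → i < n → Rows i σ → time fillRow (setReg 3 i σ) ≤ overhead fillRow + n * suc (overhead fillEntry)
  fillRow-time {i} _ rows = ℕ.+-monoʳ-≤ (suc (cost (entryAt (lit 1 ⊕ reg 3) (lit 0)) + 1))
    (for-time 4 fillEntry (InRow i) fillEntry-correct (λ _ _ → ℕ.≤-refl) {e = reg 0} (reg-0 (proj₁ (row-start rows))) (row-start rows))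

  table-start : ∀ {σ} → Inputs σ → (∀ a → array σ 2 a ≡ 0) → Rows 0 (exec (2 [ lit 0 ]≔ lit 1) σ)
  table-start {σ} (inputs r₀ r₁ a₀ a₁) zeros = inputs r₀ r₁ a₀ a₁ , filled
    where
    filled : Filled 1 0 (exec (2 [ lit 0 ]≔ lit 1) σ)
    filled {zero} {zero}  s≤n _ = refl
    -- Row 0 is never written beyond column 0; its zeros are those of the initial array.
    filled {zero} {suc s} s≤n _ = zeros (suc s)
    filled {suc _} s≤n (inj₁ (s≤s ()))

  fillTable-correct : ∀ {σ} → Inputs σ → (∀ a → array σ 2 a ≡ 0) → Rows n (exec fillTable σ)
  fillTable-correct ins zeros = for-invariant 3 fillRow Rows fillRow-correct {e = reg 0} (reg-0 ins) (table-start ins zeros)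

  fillTable-time : ∀ {σ} → Inputs σ → (∀ a → array σ 2 a ≡ 0) →
                   time fillTable σ ≤ overhead fillTable + n * suc (overhead fillRow + n * suc (overhead fillEntry))
  fillTable-time ins zeros = ℕ.+-monoʳ-≤ (suc (cost (lit 0) + 1))
    (for-time 3 fillRow Rows fillRow-correct fillRow-time {e = reg 0} (reg-0 ins) (table-start ins zeros))

  term : ℕ → ℕ
  term s = table d n s * κ (n ∸ s) * κ (m ∸ s)

  Summed : ℕ → State → Set
  Summed k σ = Rows n σ × register σ 2 ≡ ∑ (upTo k) term

  addTerm-correct : ∀ {k σ} → k < suc n → Summed k σ → Summed (suc k) (exec addTerm (setReg 3 k σ))
  addTerm-correct {k} {σ} (s≤s k≤n) ((inputs r₀ r₁ a₀ a₁ , filled) , r₂) =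
    (inputs r₀ r₁ a₀ a₁ , filled) ,
    trans (cong₂ _+_ r₂ (value r₀ r₁ a₁)) (sym (∑-upTo-suc k term))
    where
    value : ∀ {n′ m′ κ′} → n′ ≡ n → m′ ≡ m → κ′ ≡ κ →
      array σ 2 (n′ * suc n′ + k) * κ′ (n′ ∸ k) * κ′ (m′ ∸ k) ≡ term k
    value refl refl refl = cong (λ a → a * κ (n ∸ k) * κ (m ∸ k)) (filled k≤n (inj₁ ℕ.≤-refl))

  sum-start : ∀ {σ} → Rows n σ → Summed 0 (exec (2 ≔ lit 0) σ)
  sum-start (inputs r₀ r₁ a₀ a₁ , filled) = (inputs r₀ r₁ a₀ a₁ , filled) , refl

  sumTerms-correct : ∀ {σ} → Rows n σ → result (exec sumTerms σ) ≡ ∑ (upTo (suc n)) term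
  sumTerms-correct {σ} rows = proj₂ (for-invariant 3 addTerm Summed addTerm-correct {e = lit 1 ⊕ reg 0} {exec (2 ≔ lit 0) σ}
    (cong suc (reg-0 (proj₁ rows))) (sum-start rows))

  -- There are n + 1 passes, one of which is already contained in `overhead sumTerms`.
  sumTerms-time : ∀ {σ} → Rows n σ → time sumTerms σ ≤ overhead sumTerms + n * suc (overhead addTerm)
  sumTerms-time {σ} rows = ℕ.+-monoʳ-≤ 2 (for-time 3 addTerm Summed addTerm-correct (λ _ _ → ℕ.≤-refl)
    {e = lit 1 ⊕ reg 0} {exec (2 ≔ lit 0) σ} (cong suc (reg-0 (proj₁ rows))) (sum-start rows))

module PerfectExecution (n m : ℕ) (d : ℕ → ℕ) where

  -- Pass k computes entry k + 2 from entry k, so after k passes the entries up to k + 1 are right.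
  -- Array 2 must stay zero for `fillTable`.
  record Perfects (k : ℕ) (σ : State) : Set where
    constructor perfects-upTo
    field
      reg-0 : register σ 0 ≡ n
      reg-1 : register σ 1 ≡ m
      arr-0 : array σ 0 ≡ d
      arr-1 : ∀ {t} → t ≤ suc k → array σ 1 t ≡ numPerfect t
      arr-2 : ∀ a → array σ 2 a ≡ 0

  nextPerfect-correct : ∀ {k σ} → k < n + m → Perfects k σ → Perfects (suc k) (exec nextPerfect (setReg 3 k σ))
  nextPerfect-correct {k} {σ} _ (perfects-upTo r₀ r₁ a₀ a₁ a₂) = perfects-upTo r₀ r₁ a₀ next a₂
    where
    next : ∀ {t} → t ≤ suc (suc k) → array (exec nextPerfect (setReg 3 k σ)) 1 t ≡ numPerfect t
    next t≤ with ℕ.m≤n⇒m<n∨m≡n t≤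
    ... | inj₁ (s≤s t≤1+k) = trans (update-other (array σ 1) _ (ℕ.>⇒≢ (s≤s t≤1+k))) (a₁ t≤1+k)
    ... | inj₂ refl        = trans (update-same (array σ 1) {suc (suc k)} _ refl) (cong (suc k *_) (a₁ (ℕ.n≤1+n k)))

  module _ {σ} (r₀ : register σ 0 ≡ n) (r₁ : register σ 1 ≡ m) (a₀ : array σ 0 ≡ d)
           (zero₁ : ∀ a → array σ 1 a ≡ 0) (zero₂ : ∀ a → array σ 2 a ≡ 0) where

    start : Perfects 0 (exec (1 [ lit 0 ]≔ lit 1) σ)
    start = perfects-upTo r₀ r₁ a₀ first zero₂
      where
      first : ∀ {t} → t ≤ 1 → array (exec (1 [ lit 0 ]≔ lit 1) σ) 1 t ≡ numPerfect t
      first {zero}  _         = refl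
      -- Entry 1 is not written: p(K₁) = 0 is the initial content.
      first {suc _} (s≤s z≤n) = zero₁ 1

    fillPerfect-correct : Perfects (n + m) (exec fillPerfect σ)
    fillPerfect-correct = for-invariant 3 nextPerfect Perfects nextPerfect-correct {e = reg 0 ⊕ reg 1} (cong₂ _+_ r₀ r₁) start

    fillPerfect-time : time fillPerfect σ ≤ overhead fillPerfect + (n + m) * suc (overhead nextPerfect)
    fillPerfect-time = ℕ.+-monoʳ-≤ 3 (for-time 3 nextPerfect Perfects nextPerfect-correct (λ _ _ → ℕ.≤-refl)
      {e = reg 0 ⊕ reg 1} (cong₂ _+_ r₀ r₁) start)

-- The shape of two nested loops: `a` once, `b` per row, `c` per entry. The square of n + 1 also
-- absorbs the constant cost at n = 0.
quadratic : ∀ a b c n → a + n * (b + n * c) ≤ (a + b + c) * (suc n * suc n)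
quadratic a b c n = subst (a + n * (b + n * c) ≤_) (expand a b c n) (ℕ.m≤m+n _ _)
  where
  -- The third summand is the difference of the two sides, which turns the inequality into a
  -- polynomial identity.
  expand : ∀ a b c n → a + n * (b + n * c) + (a * (n * n + 2 * n) + b * (n * n + n + 1) + c * (2 * n + 1))
                     ≡ (a + b + c) * ((1 + n) * (1 + n))
  expand = solve-∀

-- Tabulating p(K_t) takes n + m passes, and m is not bounded in terms of n; this is the source of
-- the extra `m`.
linear : ∀ a b n m → a + (n + m) * b ≤ (a + b) * (suc n * suc n + m)
linear a b n m = subst (a + (n + m) * b ≤_) (expand a b n m) (ℕ.m≤m+n _ _)
  where
  expand : ∀ a b n m → a + (n + m) * b + (a * (n * n + 2 * n + m) + b * (n * n + n + 1))
                     ≡ (a + b) * ((1 + n) * (1 + n) + m)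
  expand = solve-∀

-- The programs run on the degrees of a chain ordering

module CountingPrograms {n m} (C : CoChain n m) (o : CoChain.Ordering C) where
  open OrderingProperties C o
  open CoChainProperties C hiding (N)

  d : ℕ → ℕ
  d = extend (degree o)

  fillTable-M : ∀ {κ σ} → Execution.Inputs n m d κ σ → (∀ a → array σ 2 a ≡ 0) →
    (∀ i s → i ≤ n → s ≤ n → tableEntry n i s (exec fillTable σ) ≡ M o i s)
    × time fillTable σ ≤ fillTable-factor * (suc n * suc n)
  fillTable-M {κ} {σ} ins zeros =
    (λ i s i≤n s≤n → trans (proj₂ (fillTable-correct {σ} ins zeros) s≤n (inj₁ (s≤s i≤n))) (sym (M-table i s i≤n)))
    , ℕ.≤-trans (fillTable-time {σ} ins zeros) (quadratic (overhead fillTable) (suc (overhead fillRow)) (suc (overhead fillEntry)) n)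
    where open Execution n m d κ

  sumTable-p : ∀ {κ σ} → (∀ {t} → t ≤ n ⊔ m → κ t ≡ p (K t)) →
    Execution.Inputs n m d κ σ → (∀ a → array σ 2 a ≡ 0) →
    result (exec sumTable σ) ≡ p G × time sumTable σ ≤ sumTable-factor * (suc n * suc n)
  sumTable-p {κ} {σ} κ≡p ins zeros = correct , fast
    where
    open Execution n m d κ
    rows : Rows n (exec fillTable σ)
    rows = fillTable-correct {σ} ins zeros
    correct : result (exec sumTable σ) ≡ p G
    correct = begin
      result (exec sumTable σ)
        ≡⟨ sumTerms-correct {exec fillTable σ} rows ⟩
      ∑ (upTo (suc n)) (λ s → table d n s * κ (n ∸ s) * κ (m ∸ s))
        ≡⟨ ∑-cong (upTo (suc n)) (λ {s} _ → cong₂ _*_ (cong₂ _*_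
             (trans (sym (M-table n s ℕ.≤-refl)) (M-all s))
             (κ≡p (ℕ.≤-trans (ℕ.m∸n≤m n s) (ℕ.m≤m⊔n n m))))
             (κ≡p (ℕ.≤-trans (ℕ.m∸n≤m m s) (ℕ.m≤n⊔m n m)))) ⟩
      ∑ (upTo (suc n)) (λ s → numMatchings Gᵇ s * p (K (n ∸ s)) * p (K (m ∸ s)))
        -- The formula with upper limit n in place of the minimum, as the loop computes it.
        ≡⟨ p-G (ℕ.m⊓n≤m n m) ⟨
      p G ∎
      where open ≡-Reasoning
    fast : time sumTable σ ≤ sumTable-factor * (suc n * suc n)
    fast = begin
      time fillTable σ + time sumTerms (exec fillTable σ)
        ≤⟨ ℕ.+-mono-≤ (proj₂ (fillTable-M {κ} {σ} ins zeros)) (begin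
          time sumTerms (exec fillTable σ)                          ≤⟨ sumTerms-time {exec fillTable σ} rows ⟩
          overhead sumTerms + n * suc (overhead addTerm)
            -- A zero quadratic term is inserted to bring the linear bound into the form of
            -- `quadratic`.
            ≤⟨ ℕ.+-monoʳ-≤ (overhead sumTerms) (ℕ.*-monoʳ-≤ n (ℕ.m≤m+n (suc (overhead addTerm)) (n * 0))) ⟩
          overhead sumTerms + n * (suc (overhead addTerm) + n * 0)  ≤⟨ quadratic (overhead sumTerms) (suc (overhead addTerm)) 0 n ⟩
          (overhead sumTerms + suc (overhead addTerm) + 0) * (suc n * suc n) ∎) ⟩
      fillTable-factor * (suc n * suc n) + (overhead sumTerms + suc (overhead addTerm) + 0) * (suc n * suc n)
        ≡⟨ ℕ.*-distribʳ-+ (suc n * suc n) fillTable-factor (overhead sumTerms + suc (overhead addTerm) + 0) ⟨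
      sumTable-factor * (suc n * suc n) ∎
      where open ℕ.≤-Reasoning

  fromScratch-p : let σ = input n m (degree o) (λ _ → 0) in
    result (exec fromScratch σ) ≡ p G × time fromScratch σ ≤ fromScratch-factor * (suc n * suc n + m)
  fromScratch-p = proj₁ sums , fast
    where
    open PerfectExecution n m d
    σ : State
    σ = input n m (degree o) (λ _ → 0)
    filled : Perfects (n + m) (exec fillPerfect σ)
    filled = fillPerfect-correct {σ} refl refl refl (λ _ → refl) (λ _ → refl)
    open Perfects filled
    sums : result (exec fromScratch σ) ≡ p G
         × time sumTable (exec fillPerfect σ) ≤ sumTable-factor * (suc n * suc n)
    sums = sumTable-p {array (exec fillPerfect σ) 1} {exec fillPerfect σ}
      -- The indices needed go up to n ⊔ m, which is at most n + m and hence inside the computed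
      -- part of the table.
      (λ {t} t≤ → trans (arr-1 (ℕ.m≤n⇒m≤1+n (ℕ.≤-trans t≤ (ℕ.m⊔n≤m+n n m)))) (sym (p-K t)))
      (Execution.inputs reg-0 reg-1 arr-0 refl) arr-2
    fast : time fromScratch σ ≤ fromScratch-factor * (suc n * suc n + m)
    fast = begin
      time fillPerfect σ + time sumTable (exec fillPerfect σ)
        ≤⟨ ℕ.+-mono-≤
             (ℕ.≤-trans (fillPerfect-time {σ} refl refl refl (λ _ → refl) (λ _ → refl)) (linear (overhead fillPerfect) (suc (overhead nextPerfect)) n m))
             (ℕ.≤-trans (proj₂ sums) (ℕ.*-monoʳ-≤ sumTable-factor (ℕ.m≤m+n (suc n * suc n) m))) ⟩
      (overhead fillPerfect + suc (overhead nextPerfect)) * (suc n * suc n + m) + sumTable-factor * (suc n * suc n + m)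
        ≡⟨ ℕ.*-distribʳ-+ (suc n * suc n + m) (overhead fillPerfect + suc (overhead nextPerfect)) sumTable-factor ⟨
      fromScratch-factor * (suc n * suc n + m) ∎
      where open ℕ.≤-Reasoning

-- The formula for p(G) refers to the numbers p(K_t). With these given as a table the time is
-- quadratic in n alone; computing them too adds a term linear in m. The square of n + 1 replaces
-- that of n because even n = 0 costs a constant.
mainTheorem7 : (∀ {n m} (C : CoChain n m) → let open CoChain C in
    IsClique G X
    × IsClique G Y
    × IsChainGraph Gᵇ X Y
    × p G ≡ sum (map (λ s → numMatchings Gᵇ s * p (K (n ∸ s)) * p (K (m ∸ s))) (upTo (suc (n ⊓ m))))
    × (∀ (o : Ordering) →
    (∀ s → M o n s ≡ numMatchings Gᵇ s)
    × (∀ i → i ≤ n → M o i 0 ≡ 1)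
    × (∀ i s → i < s → s ≤ n → M o i s ≡ 0)
    × (∀ (i : Fin n) s → suc s ≤ suc (toℕ i) →
    + M o (suc (toℕ i)) (suc s)
    ≡ + M o (toℕ i) (suc s) +ℤ ((+ degree o i) -ℤ (+ suc s) +ℤ 1ℤ) *ℤ (+ M o (toℕ i) s))))
    × (∃[ P ] ∃[ c ] ∀ {n m} (C : CoChain n m) → let open CoChain C in
    ∀ (o : Ordering) → let σ = input n m (degree o) (λ _ → 0) in
    (∀ i s → i ≤ n → s ≤ n → tableEntry n i s (exec P σ) ≡ M o i s)
    × time P σ ≤ c * (suc n * suc n))
    × (∃[ P ] ∃[ c ] ∀ {n m} (C : CoChain n m) → let open CoChain C in
    ∀ (o : Ordering) → let σ = input n m (degree o) (extend {suc (n ⊔ m)} (λ t → p (K (toℕ t)))) in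
    result (exec P σ) ≡ p G
    × time P σ ≤ c * (suc n * suc n))
    × (∃[ P ] ∃[ c ] ∀ {n m} (C : CoChain n m) → let open CoChain C in
    ∀ (o : Ordering) → let σ = input n m (degree o) (λ _ → 0) in
    result (exec P σ) ≡ p G
    × time P σ ≤ c * (suc n * suc n + m))
mainTheorem7 =
  (λ C → let open CoChainProperties C in
    clique-X , clique-Y , isChain-Gᵇ , p-G ℕ.≤-refl ,
    λ o → let open OrderingProperties C o in
      M-all ,
      (λ i _ → M-0 i) ,
      (λ i s i<s s≤n → trans (M-table i s (ℕ.≤-trans (ℕ.<⇒≤ i<s) s≤n)) (table-< (extend (CoChain.degree C o)) i<s)) ,
      (λ i s _ → M-recurrence i s)) ,
  (fillTable , fillTable-factor , λ {n} {m} C o →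
    CountingPrograms.fillTable-M C o {σ = input n m (CoChain.degree C o) (λ _ → 0)} (Execution.inputs refl refl refl refl) (λ _ → refl)) ,
  (sumTable , sumTable-factor , λ {n} {m} C o →
    CountingPrograms.sumTable-p C o {σ = input n m (CoChain.degree C o) (extend {suc (n ⊔ m)} (λ t → p (K (toℕ t))))}
      (λ t≤ → trans (extend-< (λ t → p (K (toℕ t))) (s≤s t≤)) (cong (p ∘ K) (Fin.toℕ-fromℕ< (s≤s t≤))))
      (Execution.inputs refl refl refl refl) (λ _ → refl)) ,
  (fromScratch , fromScratch-factor , λ C o → CountingPrograms.fromScratch-p C o)
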